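{- Let $\mathcal H=(V,\mathcal E)$ be a Steiner system (a $2$-$(n,k,1)$ design with $2\le k\le n$). The following are equivalent: (i) $f_{\mathcal H}$ is join-irreducible; (ii) $\mathcal H_e\cong\mathcal H_{e'}$ for all $e,e'\in[V]^2$; (iii) $\mathcal H$ is $-2$-monomorphic.
   Context: A hypergraph $\mathcal H=(V,\mathcal E)$ consists of a finite nonempty set $V=\{1,\dots,n\}$ and a collection $\mathcal E$ of subsets of $V$; $f_{\mathcal H}\colon\{0,1\}^n\to\{0,1\}$ is the function computed by the $GF(2)$ polynomial $\sum_{E\in\mathcal E}\prod_{i\in E}x_i$. $[V]^m$ denotes the set of $m$-element subsets of $V$. $\mathcal H$ is a $2$-$(n,k,\lambda)$ design if $|V|=n$, $\mathcal E\subseteq[V]^k$ and every $e\in[V]^2$ is contained in exactly $\lambda$ hyperedges; it is a Steiner system if $\lambda=1$. Hypergraphs $(V,\mathcal E)$, $(V',\mathcal E')$ are isomorphic ($\cong$) if there is a bijection $\varphi\colon V\to V'$ with $E\in\mathcal E\iff\varphi(E)\in\mathcal E'$. For $e=\{i,j\}\in[V]^2$ and a new element $l_e\notin V$, let $h\colon V\to V_e=(V\setminus e)\cup\{l_e\}$ map $i,j$ to $l_e$ and fix all other vertices; $\mathcal H_e=(V_e,\mathcal E_e)$ where $E\in\mathcal E_e$ iff the number of $E'\in\mathcal E$ with $h(E')=E$ is odd. Let $\mathcal H_{ -e}$ be the induced hypergraph $(V\setminus e,\{E\in\mathcal E:E\subseteq V\setminus e\})$; $\mathcal H$ is $-2$-monomorphic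 if $\mathcal H_{ -e}\cong\mathcal H_{ -e'}$ for all $e,e'\in[V]^2$. Simple minor order on Boolean functions: $g\le f$ if there is $\sigma$ with $g(a_1,\dots,a_m)=f(a_{\sigma(1)},\dots,a_{\sigma(n)})$ for all $a_i$; $g<f$ if $g\le f$, $f\not\le g$. $f$ is join-irreducible if there is $f'<f$ such that every $g<f$ satisfies $g\le f'$. -}

module Defs where

open import Data.Nat using (ℕ; zero; suc)
open import Data.Bool using (Bool; true; false; _∧_; _∨_; not; _xor_; if_then_else_)
open import Data.Fin using (Fin; _<_; punchIn; punchOut; _≟_)
open import Data.Fin.Properties using (<⇒≢)
open import Data.Fin.Subset using (Subset; ⁅_⁆; _∪_; ∣_∣)
import Data.Fin.Subset as S
open import Data.Vec using (Vec; []; _∷_; lookup)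
import Data.Vec.Properties as VP
import Data.Bool.Properties as BP
open import Data.List using (List; []; _∷_; map; foldr; filter; length; allFin; _++_)
open import Data.Product using (Σ; _,_; _×_)
open import Function using (_∘_)
open import Function.Bundles using (_⤖_; Bijection)
open import Relation.Binary.PropositionalEquality using (_≡_; _≢_; sym)
open import Relation.Nullary using (¬_; Dec; yes; no; does)

Hypergraph : ℕ → Set
Hypergraph n = Subset n → Bool

allSubsets : (n : ℕ) → List (Subset n)
allSubsets zero    = [] ∷ []
allSubsets (suc n) = map (true ∷_) (allSubsets n) ++ map (false ∷_) (allSubsets n)

_==ˢ_ : ∀ {n} → Subset n → Subset n → Bool
A ==ˢ B = does (VP.≡-dec BP._≟_ A B)

countS : ∀ n → (Subset n → Bool) → ℕ
countS n P = length (filter (λ E → Data.Bool._≟_ (P E) true) (allSubsets n))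
  where import Data.Bool

_∈ᵇ_ : ∀ {n} → Fin n → Subset n → Bool
i ∈ᵇ E = lookup E i

image : ∀ {n m} → (Fin n → Fin m) → Subset n → Subset m
image {n} φ E = foldr (λ x acc → if x ∈ᵇ E then ⁅ φ x ⁆ ∪ acc else acc) S.⊥ (allFin n)

-- The GF(2) polynomial  Σ_{E ∈ 𝓔} Π_{i ∈ E} x_i  as a Boolean function.
allOnes : ∀ {n} → Subset n → (Fin n → Bool) → Bool
allOnes {n} E a = foldr (λ i b → (not (i ∈ᵇ E) ∨ a i) ∧ b) true (allFin n)

fH : ∀ {n} → Hypergraph n → (Fin n → Bool) → Bool
fH {n} H a = foldr _xor_ false (map (λ E → H E ∧ allOnes E a) (allSubsets n))

Is2Design : (n k λ′ : ℕ) → Hypergraph n → Set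
Is2Design n k λ′ H =
  (∀ E → H E ≡ true → ∣ E ∣ ≡ k) ×
  (∀ (i j : Fin n) → i < j →
     countS n (λ E → H E ∧ (i ∈ᵇ E) ∧ (j ∈ᵇ E)) ≡ λ′)

IsSteiner : (n k : ℕ) → Hypergraph n → Set
IsSteiner n k H = Is2Design n k 1 H

_≅_ : ∀ {n m} → Hypergraph n → Hypergraph m → Set
_≅_ {n} {m} H H′ =
  Σ (Fin n ⤖ Fin m) λ φ → ∀ E → H E ≡ H′ (image (Bijection.to φ) E)

-- Contraction H_e for e = {i, j}, i < j, on V = Fin (suc m).
-- V_e = (V ∖ e) ∪ {l_e} is realised concretely as Fin m: vertex j is
-- punched out and the image of i plays the role of the new vertex l_e.

contractMap : ∀ {m} (i j : Fin (suc m)) → i < j → Fin (suc m) → Fin m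
contractMap i j i<j x with j ≟ x
... | yes _   = punchOut {i = j} {j = i} (λ p → <⇒≢ i<j (sym p))
... | no j≢x = punchOut j≢x

contract : ∀ {m} → Hypergraph (suc m) → (i j : Fin (suc m)) → i < j → Hypergraph m
contract {m} H i j i<j E =
  Data.Nat._≡ᵇ_ 1 (Data.Nat._%_ (countS (suc m) (λ E′ → H E′ ∧ (image (contractMap i j i<j) E′ ==ˢ E))) 2)
  where import Data.Nat

-- Induced hypergraph H_{-e} for e = {i, j}, i < j, on V = Fin (suc (suc m)).
-- V ∖ e is realised as Fin m via the injection  x ↦ punchIn j (punchIn i′ x),
-- where i′ is the position of i once j is removed.

deleteEmb : ∀ {m} (i j : Fin (suc (suc m))) → i < j → Fin m → Fin (suc (suc m))
deleteEmb i j i<j x = punchIn j (punchIn (punchOut {i = j} {j = i} (λ p → <⇒≢ i<j (sym p))) x)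

delete : ∀ {m} → Hypergraph (suc (suc m)) → (i j : Fin (suc (suc m))) → i < j → Hypergraph m
delete H i j i<j E = H (image (deleteEmb i j i<j) E)

Minus2Monomorphic : ∀ {m} → Hypergraph (suc (suc m)) → Set
Minus2Monomorphic {m} H =
  ∀ (i j : Fin (suc (suc m))) (i<j : i < j) (i′ j′ : Fin (suc (suc m))) (i′<j′ : i′ < j′) →
    delete H i j i<j ≅ delete H i′ j′ i′<j′

ContractionsIsomorphic : ∀ {m} → Hypergraph (suc m) → Set
ContractionsIsomorphic {m} H =
  ∀ (i j : Fin (suc m)) (i<j : i < j) (i′ j′ : Fin (suc m)) (i′<j′ : i′ < j′) →
    contract H i j i<j ≅ contract H i′ j′ i′<j′

BF : Set
BF = Σ ℕ λ n → (Fin n → Bool) → Bool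

_≤m_ : BF → BF → Set
(m , g) ≤m (n , f) = Σ (Fin n → Fin m) λ σ → ∀ (a : Fin m → Bool) → g a ≡ f (a ∘ σ)

_<m_ : BF → BF → Set
g <m f = (g ≤m f) × ¬ (f ≤m g)

JoinIrreducible : BF → Set
JoinIrreducible f = Σ BF λ f′ → (f′ <m f) × (∀ g → g <m f → g ≤m f′)

{-# OPTIONS --safe #-}

-- Identifying two variables of f_H gives the polynomial of the contraction H_e, and every
-- g < f_H lies below such a minor.  So H_e ≅ H_e′ for all pairs makes f_H join-irreducible.
-- Conversely all variables of f_{H_e} are essential when k ≥ 3, so that comparable
-- contractions are isomorphic, polynomials over GF(2) being unique.
--
-- For k ≥ 3 contraction is injective on edges.  If the line E₀ through e misses a point, the
-- vertex l_e is recognised in H_e as the centre of the star formed by the pairs that lie in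
-- two edges; hence H_e determines H_{-e}.  (If E₀ = V, all deletions are empty.)  In H_{-e}
-- call two vertices adjacent if no edge joins them, i.e. if their line in H meets e.
-- Triangles of this graph are collinear, and a vertex is on E₀ iff its neighbours are pairwise
-- adjacent; this recovers the edges of H_e through l_e.
--
-- For k = 2 the hypergraph is complete and all three conditions hold.
module Submission where

open import Defs
open import Data.Nat using (ℕ; zero; suc; _≤_; _<_; z≤n; s≤s; _≡ᵇ_; _%_)
import Data.Nat.Properties as ℕₚ
open import Data.Bool using (Bool; true; false; _∧_; _∨_; not; _xor_; if_then_else_) renaming (_≟_ to _≟ᵇ_)
import Data.Bool.Properties as Bₚ
open import Data.Fin using (Fin; zero; suc; punchIn; punchOut; _≟_)
import Data.Fin as F
import Data.Fin.Properties as Fₚ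
open import Data.Fin.Permutation using (Permutation; Permutation′; _⟨$⟩ʳ_; _⟨$⟩ˡ_; flip; inverseˡ; inverseʳ; insert; remove; insert-punchIn; punchIn-permute)
import Data.Fin.Permutation as Perm
open import Data.Fin.Subset using (Subset; ⁅_⁆; _∪_; ∣_∣)
import Data.Fin.Subset as S
import Data.Fin.Subset.Properties as Sₚ
open import Data.Vec using ([]; _∷_; lookup; tabulate)
import Data.Vec.Properties as Vₚ
open import Data.List using (List; []; _∷_; map; foldr; filter; length; allFin; _++_)
import Data.List.Properties as Lₚ
open import Data.List.Membership.Propositional using () renaming (_∈_ to _∈ˡ_)
open import Data.List.Membership.Propositional.Properties using (∈-allFin; ∈-filter⁺; ∈-filter⁻; ∈-++⁺ˡ; ∈-++⁺ʳ; ∈-map⁺)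
open import Data.List.Relation.Unary.Any using (here; there)
open import Data.Product using (Σ; ∃; ∃₂; _×_; _,_; proj₁; proj₂)
open import Data.Sum using (_⊎_; inj₁; inj₂; [_,_]′)
open import Data.Empty using (⊥-elim)
open import Function using (_∘_; id; mk⇔)
open import Function.Bundles using (_⇔_)
open import Function.Definitions using (Injective)
open import Function.Properties.Inverse using (↔⇒⤖)
open import Function.Properties.Bijection using (⤖⇒↔)
open import Relation.Nullary using (¬_; Dec; yes; no)
open import Relation.Nullary.Decidable using (dec-true; dec-false; _×-dec_; _⊎-dec_; ¬?)
open import Relation.Binary.Definitions using (tri<; tri≈; tri>)
open import Relation.Binary.PropositionalEquality using (_≡_; _≢_; _≗_; refl; sym; trans; cong; cong₂; subst; module ≡-Reasoning)
open import Algebra.Bundles using (module CommutativeRing)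
open import Algebra.Properties.CommutativeSemigroup (CommutativeRing.+-commutativeSemigroup Bₚ.xor-∧-commutativeRing) using (interchange)
open ≡-Reasoning

-- Subsets, images and monomials

infix 4 _∈_ _∉_

_∈_ _∉_ : ∀ {n} → Fin n → Subset n → Set
x ∈ E = (x ∈ᵇ E) ≡ true
x ∉ E = ¬ (x ∈ E)

⇔⇒≡ : ∀ {a b : Bool} → (a ≡ true → b ≡ true) → (b ≡ true → a ≡ true) → a ≡ b
⇔⇒≡ f g = Bₚ.⇔→≡ (mk⇔ f g)

subset-ext : ∀ {n} {A B : Subset n} → (∀ x → (x ∈ᵇ A) ≡ (x ∈ᵇ B)) → A ≡ B
subset-ext {A = A} {B} eq = trans (sym (Vₚ.tabulate∘lookup A)) (trans (Vₚ.tabulate-cong eq) (Vₚ.tabulate∘lookup B))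

∈-⁅⁆⁺ : ∀ {n} (x : Fin n) → x ∈ ⁅ x ⁆
∈-⁅⁆⁺ x = Vₚ.[]=⇒lookup (Sₚ.x∈⁅x⁆ x)

∈-⁅⁆⁻ : ∀ {n} {x y : Fin n} → x ∈ ⁅ y ⁆ → x ≡ y
∈-⁅⁆⁻ {y = y} p = Sₚ.x∈⁅y⁆⇒x≡y y (Vₚ.lookup⇒[]= _ _ p)

∈-∪⁻ : ∀ {n} {x : Fin n} (A B : Subset n) → x ∈ A ∪ B → x ∈ A ⊎ x ∈ B
∈-∪⁻ {x = x} A B p with lookup A x | lookup B x | trans (sym (Vₚ.lookup-zipWith _∨_ x A B)) p
... | true  | _    | _ = inj₁ refl
... | false | true | _ = inj₂ refl

∈-∪⁺ˡ : ∀ {n} {x : Fin n} (A B : Subset n) → x ∈ A → x ∈ A ∪ B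
∈-∪⁺ˡ {x = x} A B p = trans (Vₚ.lookup-zipWith _∨_ x A B) (cong (_∨ lookup B x) p)

∈-∪⁺ʳ : ∀ {n} {x : Fin n} (A B : Subset n) → x ∈ B → x ∈ A ∪ B
∈-∪⁺ʳ {x = x} A B p = trans (Vₚ.lookup-zipWith _∨_ x A B) (trans (cong (lookup A x ∨_) p) (Bₚ.∨-zeroʳ _))

∉⊥ : ∀ {n} {x : Fin n} → x ∉ S.⊥
∉⊥ {x = x} p with () ← trans (sym (Vₚ.lookup-replicate x false)) p

_∈?_ : ∀ {n} (x : Fin n) (E : Subset n) → Dec (x ∈ E)
x ∈? E = (x ∈ᵇ E) ≟ᵇ true

module _ {n m} (φ : Fin n → Fin m) (E : Subset n) where

  private
    step : Fin n → Subset m → Subset m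
    step x acc = if x ∈ᵇ E then ⁅ φ x ⁆ ∪ acc else acc

    fold⁺ : ∀ {x} xs → x ∈ˡ xs → x ∈ E → φ x ∈ foldr step S.⊥ xs
    fold⁺ (x ∷ xs) (here refl) p rewrite p = ∈-∪⁺ˡ ⁅ φ x ⁆ _ (∈-⁅⁆⁺ (φ x))
    fold⁺ (z ∷ xs) (there q) p with z ∈ᵇ E
    ... | true  = ∈-∪⁺ʳ ⁅ φ z ⁆ _ (fold⁺ xs q p)
    ... | false = fold⁺ xs q p

    fold⁻ : ∀ {y} xs → y ∈ foldr step S.⊥ xs → ∃ λ x → x ∈ E × φ x ≡ y
    fold⁻ {y} [] p = ⊥-elim (∉⊥ {x = y} p)
    fold⁻ (z ∷ xs) p with z ∈ᵇ E in eq
    ... | false = fold⁻ xs p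
    ... | true  with ∈-∪⁻ ⁅ φ z ⁆ _ p
    ...   | inj₁ q = z , eq , sym (∈-⁅⁆⁻ q)
    ...   | inj₂ q = fold⁻ xs q

  ∈-image⁺ : ∀ {x} → x ∈ E → φ x ∈ image φ E
  ∈-image⁺ = fold⁺ (allFin n) (∈-allFin _)

  ∈-image⁻ : ∀ {y} → y ∈ image φ E → ∃ λ x → x ∈ E × φ x ≡ y
  ∈-image⁻ = fold⁻ (allFin n)

∈-image-injective : ∀ {n m} {φ : Fin n → Fin m} → Injective _≡_ _≡_ φ → ∀ E x → (φ x ∈ᵇ image φ E) ≡ (x ∈ᵇ E)
∈-image-injective {φ = φ} inj E x = ⇔⇒≡ to (∈-image⁺ φ E)
  where
  to : φ x ∈ image φ E → x ∈ E
  to p with y , y∈E , eq ← ∈-image⁻ φ E p = subst (_∈ E) (inj eq) y∈E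

image-∘ : ∀ {n m o} (g : Fin m → Fin o) (f : Fin n → Fin m) E → image g (image f E) ≡ image (g ∘ f) E
image-∘ g f E = subset-ext λ y → ⇔⇒≡ (to y) (from y)
  where
  to : ∀ y → y ∈ image g (image f E) → y ∈ image (g ∘ f) E
  to y p with z , z∈ , refl ← ∈-image⁻ g (image f E) p with x , x∈ , refl ← ∈-image⁻ f E z∈ = ∈-image⁺ (g ∘ f) E x∈
  from : ∀ y → y ∈ image (g ∘ f) E → y ∈ image g (image f E)
  from y p with x , x∈ , refl ← ∈-image⁻ (g ∘ f) E p = ∈-image⁺ g (image f E) (∈-image⁺ f E x∈)

image-cong : ∀ {n m} {f g : Fin n → Fin m} → f ≗ g → ∀ E → image f E ≡ image g E
image-cong {f = f} {g} eq E = subset-ext λ y → ⇔⇒≡ (one f g eq) (one g f (sym ∘ eq))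
  where
  one : ∀ f g → f ≗ g → ∀ {y} → y ∈ image f E → y ∈ image g E
  one f g eq p with x , x∈ , refl ← ∈-image⁻ f E p = subst (_∈ image g E) (sym (eq x)) (∈-image⁺ g E x∈)

image-id : ∀ {n} (E : Subset n) → image id E ≡ E
image-id E = subset-ext (∈-image-injective {φ = id} id E)

module _ {n} (E : Subset n) (a : Fin n → Bool) where

  private
    step : Fin n → Bool → Bool
    step i b = (not (i ∈ᵇ E) ∨ a i) ∧ b

    fold⁺ : ∀ xs → (∀ x → x ∈ E → a x ≡ true) → foldr step true xs ≡ true
    fold⁺ [] h = refl
    fold⁺ (x ∷ xs) h with x ∈ᵇ E in eq
    ... | false = fold⁺ xs h
    ... | true rewrite h x eq = fold⁺ xs h

    fold⁻ : ∀ {x} xs → x ∈ˡ xs → foldr step true xs ≡ true → x ∈ E → a x ≡ true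
    fold⁻ {x} (_ ∷ xs) (here refl) p q rewrite q = Bₚ.∧-conicalˡ (a x) _ p
    fold⁻ (z ∷ xs) (there r) p q = fold⁻ xs r (Bₚ.∧-conicalʳ (not (z ∈ᵇ E) ∨ a z) _ p) q

  allOnes⁺ : (∀ x → x ∈ E → a x ≡ true) → allOnes E a ≡ true
  allOnes⁺ = fold⁺ (allFin n)

  allOnes⁻ : allOnes E a ≡ true → ∀ x → x ∈ E → a x ≡ true
  allOnes⁻ p x = fold⁻ (allFin n) (∈-allFin x) p

-- Identifying variables in a monomial may produce repeated factors; on Boolean values a power
-- equals its base, so only the image as a set matters.
allOnes-image : ∀ {n m} (σ : Fin n → Fin m) E a → allOnes (image σ E) a ≡ allOnes E (a ∘ σ)
allOnes-image σ E a = ⇔⇒≡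
  (λ p → allOnes⁺ E (a ∘ σ) λ x x∈ → allOnes⁻ (image σ E) a p (σ x) (∈-image⁺ σ E x∈))
  (λ p → allOnes⁺ (image σ E) a (from p))
  where
  from : allOnes E (a ∘ σ) ≡ true → ∀ y → y ∈ image σ E → a y ≡ true
  from p y q with x , x∈ , refl ← ∈-image⁻ σ E q = allOnes⁻ E (a ∘ σ) p x x∈

allOnes-cong : ∀ {n} (E : Subset n) {a b : Fin n → Bool} → a ≗ b → allOnes E a ≡ allOnes E b
allOnes-cong E {a} {b} eq = ⇔⇒≡
  (λ p → allOnes⁺ E b λ x x∈ → trans (sym (eq x)) (allOnes⁻ E a p x x∈))
  (λ p → allOnes⁺ E a λ x x∈ → trans (eq x) (allOnes⁻ E b p x x∈))

==ˢ⇒≡ : ∀ {n} (A B : Subset n) → (A ==ˢ B) ≡ true → A ≡ B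
==ˢ⇒≡ A B p with Vₚ.≡-dec Bₚ._≟_ A B
... | yes eq = eq

==ˢ-refl : ∀ {n} (A : Subset n) → (A ==ˢ A) ≡ true
==ˢ-refl A = dec-true (Vₚ.≡-dec Bₚ._≟_ A A) refl

==ˢ-≢ : ∀ {n} {A B : Subset n} → A ≢ B → (A ==ˢ B) ≡ false
==ˢ-≢ {A = A} {B} = dec-false (Vₚ.≡-dec Bₚ._≟_ A B)

-- Sums over GF(2)

-- The recursion follows that of `allSubsets`, so that splitting a polynomial by its first variable
-- holds by definition.
⨁ : ∀ n → (Subset n → Bool) → Bool
⨁ zero    f = f []
⨁ (suc n) f = ⨁ n (f ∘ (true ∷_)) xor ⨁ n (f ∘ (false ∷_))

xorSum : List Bool → Bool
xorSum = foldr _xor_ false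

xorSum-++ : ∀ xs ys → xorSum (xs ++ ys) ≡ xorSum xs xor xorSum ys
xorSum-++ [] ys = refl
xorSum-++ (x ∷ xs) ys = trans (cong (x xor_) (xorSum-++ xs ys)) (sym (Bₚ.xor-assoc x _ _))

xorSum-allSubsets : ∀ n (f : Subset n → Bool) → xorSum (map f (allSubsets n)) ≡ ⨁ n f
xorSum-allSubsets zero f = Bₚ.xor-identityʳ _
xorSum-allSubsets (suc n) f = begin
  xorSum (map f (map (true ∷_) (allSubsets n) ++ map (false ∷_) (allSubsets n)))
    ≡⟨ cong xorSum (Lₚ.map-++ f (map (true ∷_) (allSubsets n)) _) ⟩
  xorSum (map f (map (true ∷_) (allSubsets n)) ++ map f (map (false ∷_) (allSubsets n)))
    ≡⟨ xorSum-++ (map f (map (true ∷_) (allSubsets n))) _ ⟩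
  xorSum (map f (map (true ∷_) (allSubsets n))) xor xorSum (map f (map (false ∷_) (allSubsets n)))
    ≡⟨ cong₂ _xor_ (half true) (half false) ⟩
  ⨁ (suc n) f ∎
  where
  half : ∀ b → xorSum (map f (map (b ∷_) (allSubsets n))) ≡ ⨁ n (f ∘ (b ∷_))
  half b = trans (cong xorSum (sym (Lₚ.map-∘ (allSubsets n)))) (xorSum-allSubsets n (f ∘ (b ∷_)))

⨁-cong : ∀ n {f g : Subset n → Bool} → f ≗ g → ⨁ n f ≡ ⨁ n g
⨁-cong zero eq = eq []
⨁-cong (suc n) eq = cong₂ _xor_ (⨁-cong n (λ E → eq (true ∷ E))) (⨁-cong n (λ E → eq (false ∷ E)))

⨁-xor : ∀ n (f g : Subset n → Bool) → ⨁ n (λ E → f E xor g E) ≡ ⨁ n f xor ⨁ n g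
⨁-xor zero f g = refl
⨁-xor (suc n) f g = trans
  (cong₂ _xor_ (⨁-xor n (f ∘ (true ∷_)) (g ∘ (true ∷_))) (⨁-xor n (f ∘ (false ∷_)) (g ∘ (false ∷_))))
  (interchange (⨁ n (f ∘ (true ∷_))) _ _ _)

⨁-false : ∀ n {f : Subset n → Bool} → (∀ E → f E ≡ false) → ⨁ n f ≡ false
⨁-false zero h = h []
⨁-false (suc n) h rewrite ⨁-false n (λ E → h (true ∷ E)) = ⨁-false n (λ E → h (false ∷ E))

⨁-swap : ∀ n m (f : Subset n → Subset m → Bool) → ⨁ n (λ A → ⨁ m (f A)) ≡ ⨁ m (λ B → ⨁ n (λ A → f A B))
⨁-swap zero m f = refl
⨁-swap (suc n) m f = trans
  (cong₂ _xor_ (⨁-swap n m (f ∘ (true ∷_))) (⨁-swap n m (f ∘ (false ∷_))))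
  (sym (⨁-xor m _ _))

⨁-∧ʳ : ∀ n (f : Subset n → Bool) c → ⨁ n f ∧ c ≡ ⨁ n (λ E → f E ∧ c)
⨁-∧ʳ zero f c = refl
⨁-∧ʳ (suc n) f c = trans (Bₚ.∧-distribʳ-xor c (⨁ n (f ∘ (true ∷_))) _)
  (cong₂ _xor_ (⨁-∧ʳ n (f ∘ (true ∷_)) c) (⨁-∧ʳ n (f ∘ (false ∷_)) c))

⨁-single : ∀ {n} (f : Subset n → Bool) A → (∀ E → E ≢ A → f E ≡ false) → ⨁ n f ≡ f A
⨁-single f [] h = refl
⨁-single {suc n} f (true ∷ A) h = trans
  (cong₂ _xor_ (⨁-single (f ∘ (true ∷_)) A (λ E ne → h (true ∷ E) (ne ∘ Vₚ.∷-injectiveʳ)))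
               (⨁-false n (λ E → h (false ∷ E) λ ())))
  (Bₚ.xor-identityʳ _)
⨁-single {suc n} f (false ∷ A) h = cong₂ _xor_ (⨁-false n (λ E → h (true ∷ E) λ ()))
  (⨁-single (f ∘ (false ∷_)) A (λ E ne → h (false ∷ E) (ne ∘ Vₚ.∷-injectiveʳ)))

⨁-true⁻ : ∀ n (f : Subset n → Bool) → ⨁ n f ≡ true → ∃ λ E → f E ≡ true
⨁-true⁻ zero f p = [] , p
⨁-true⁻ (suc n) f p with ⨁ n (f ∘ (true ∷_)) in eq
... | true with E , q ← ⨁-true⁻ n (f ∘ (true ∷_)) eq = true ∷ E , q
... | false with E , q ← ⨁-true⁻ n (f ∘ (false ∷_)) p = false ∷ E , q

-- Bridges the arithmetic parity test in `contract` and sums over GF(2).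
parity-filter : ∀ {A : Set} (P : A → Bool) xs → (1 ≡ᵇ length (filter (λ x → P x ≟ᵇ true) xs) % 2) ≡ xorSum (map P xs)
parity-filter P [] = refl
parity-filter P (x ∷ xs) with P x
... | false = parity-filter P xs
... | true = trans (flip-parity (length (filter (λ x → P x ≟ᵇ true) xs))) (cong not (parity-filter P xs))
  where
  flip-parity : ∀ n → (1 ≡ᵇ suc n % 2) ≡ not (1 ≡ᵇ n % 2)
  flip-parity zero = refl
  flip-parity (suc zero) = refl
  flip-parity (suc (suc n)) = flip-parity n

-- Hypergraphs as polynomials

fH-⨁ : ∀ {n} (H : Hypergraph n) a → fH H a ≡ ⨁ n (λ E → H E ∧ allOnes E a)
fH-⨁ {n} H a = xorSum-allSubsets n _

fH-cong : ∀ {n} (H : Hypergraph n) {a b} → a ≗ b → fH H a ≡ fH H b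
fH-cong {n} H {a} {b} eq = trans (fH-⨁ H a) (trans (⨁-cong n λ E → cong (H E ∧_) (allOnes-cong E eq)) (sym (fH-⨁ H b)))

fH-≗ : ∀ {n} {H G : Hypergraph n} → H ≗ G → fH H ≗ fH G
fH-≗ {n} {H} {G} eq a = trans (fH-⨁ H a) (trans (⨁-cong n λ E → cong (_∧ allOnes E a) (eq E)) (sym (fH-⨁ G a)))

-- On functions this is the substitution x_i := x_{σ i}; contract is the case σ = contractMap.
push : ∀ {n m} → (Fin n → Fin m) → Hypergraph n → Hypergraph m
push {n} σ H Y = ⨁ n (λ E → H E ∧ (image σ E ==ˢ Y))

-- After exchanging the two sums, each edge `E` contributes at the single set `Y = image σ E`.
fH-push : ∀ {n m} (σ : Fin n → Fin m) (H : Hypergraph n) a → fH (push σ H) a ≡ fH H (a ∘ σ)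
fH-push {n} {m} σ H a = begin
  fH (push σ H) a
    ≡⟨ fH-⨁ (push σ H) a ⟩
  ⨁ m (λ Y → ⨁ n (λ E → H E ∧ (image σ E ==ˢ Y)) ∧ allOnes Y a)
    ≡⟨ ⨁-cong m (λ Y → ⨁-∧ʳ n _ (allOnes Y a)) ⟩
  ⨁ m (λ Y → ⨁ n (λ E → (H E ∧ (image σ E ==ˢ Y)) ∧ allOnes Y a))
    ≡⟨ ⨁-swap m n _ ⟩
  ⨁ n (λ E → ⨁ m (λ Y → (H E ∧ (image σ E ==ˢ Y)) ∧ allOnes Y a))
    ≡⟨ ⨁-cong n collapse ⟩
  ⨁ n (λ E → H E ∧ allOnes E (a ∘ σ))
    ≡⟨ fH-⨁ H (a ∘ σ) ⟨
  fH H (a ∘ σ) ∎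
  where
  collapse : ∀ E → ⨁ m (λ Y → (H E ∧ (image σ E ==ˢ Y)) ∧ allOnes Y a) ≡ H E ∧ allOnes E (a ∘ σ)
  collapse E = trans (⨁-single _ (image σ E) off) on
    where
    off : ∀ Y → Y ≢ image σ E → (H E ∧ (image σ E ==ˢ Y)) ∧ allOnes Y a ≡ false
    off Y ne rewrite ==ˢ-≢ (ne ∘ sym) | Bₚ.∧-zeroʳ (H E) = refl
    on : (H E ∧ (image σ E ==ˢ image σ E)) ∧ allOnes (image σ E) a ≡ H E ∧ allOnes E (a ∘ σ)
    on rewrite ==ˢ-refl (image σ E) | Bₚ.∧-identityʳ (H E) | allOnes-image σ E a = refl

consᶠ : ∀ {n} → Bool → (Fin n → Bool) → Fin (suc n) → Bool
consᶠ b a zero    = b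
consᶠ b a (suc i) = a i

allOnes-∷ : ∀ {n} x (E : Subset n) b a → allOnes (x ∷ E) (consᶠ b a) ≡ (not x ∨ b) ∧ allOnes E a
allOnes-∷ x E b a = ⇔⇒≡ (to x) (from x)
  where
  tail⁻ : ∀ y → allOnes (y ∷ E) (consᶠ b a) ≡ true → allOnes E a ≡ true
  tail⁻ y p = allOnes⁺ E a λ i → allOnes⁻ (y ∷ E) (consᶠ b a) p (suc i)
  to : ∀ y → allOnes (y ∷ E) (consᶠ b a) ≡ true → (not y ∨ b) ∧ allOnes E a ≡ true
  to true  p = cong₂ _∧_ (allOnes⁻ (true ∷ E) (consᶠ b a) p zero refl) (tail⁻ true p)
  to false p = tail⁻ false p
  from : ∀ y → (not y ∨ b) ∧ allOnes E a ≡ true → allOnes (y ∷ E) (consᶠ b a) ≡ true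
  from y p = allOnes⁺ (y ∷ E) (consᶠ b a) λ
    { zero refl → Bₚ.∧-conicalˡ b _ p
    ; (suc i) i∈ → allOnes⁻ E a (Bₚ.∧-conicalʳ (not y ∨ b) _ p) i i∈ }

-- Write the polynomial as x₀P + Q, where P collects the edges through the first vertex and Q the
-- others. Setting x₀ = 0 leaves Q; setting x₀ = 1 leaves P + Q.
fH-restrict₀ : ∀ {n} (H : Hypergraph (suc n)) a → fH H (consᶠ false a) ≡ fH (H ∘ (false ∷_)) a
fH-restrict₀ {n} H a = begin
  fH H (consᶠ false a)
    ≡⟨ fH-⨁ H _ ⟩
  ⨁ n (λ E → H (true ∷ E) ∧ allOnes (true ∷ E) (consᶠ false a)) xor ⨁ n (λ E → H (false ∷ E) ∧ allOnes (false ∷ E) (consᶠ false a))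
    ≡⟨ cong₂ _xor_
         (⨁-false n λ E → trans (cong (H (true ∷ E) ∧_) (allOnes-∷ true E false a)) (Bₚ.∧-zeroʳ _))
         (⨁-cong n λ E → cong (H (false ∷ E) ∧_) (allOnes-∷ false E false a)) ⟩
  ⨁ n (λ E → H (false ∷ E) ∧ allOnes E a)
    ≡⟨ fH-⨁ (H ∘ (false ∷_)) a ⟨
  fH (H ∘ (false ∷_)) a ∎

fH-restrict₁ : ∀ {n} (H : Hypergraph (suc n)) a → fH H (consᶠ true a) ≡ fH (H ∘ (true ∷_)) a xor fH (H ∘ (false ∷_)) a
fH-restrict₁ {n} H a = begin
  fH H (consᶠ true a)
    ≡⟨ fH-⨁ H _ ⟩
  ⨁ n (λ E → H (true ∷ E) ∧ allOnes (true ∷ E) (consᶠ true a)) xor ⨁ n (λ E → H (false ∷ E) ∧ allOnes (false ∷ E) (consᶠ true a))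
    ≡⟨ cong₂ _xor_
         (⨁-cong n λ E → cong (H (true ∷ E) ∧_) (allOnes-∷ true E true a))
         (⨁-cong n λ E → cong (H (false ∷ E) ∧_) (allOnes-∷ false E true a)) ⟩
  ⨁ n (λ E → H (true ∷ E) ∧ allOnes E a) xor ⨁ n (λ E → H (false ∷ E) ∧ allOnes E a)
    ≡⟨ cong₂ _xor_ (fH-⨁ (H ∘ (true ∷_)) a) (fH-⨁ (H ∘ (false ∷_)) a) ⟨
  fH (H ∘ (true ∷_)) a xor fH (H ∘ (false ∷_)) a ∎

xor-cancelʳ : ∀ a b c → a xor c ≡ b xor c → a ≡ b
xor-cancelʳ true  true  c p = refl
xor-cancelʳ false false c p = refl
xor-cancelʳ true  false c p = ⊥-elim (Bₚ.not-¬ refl (sym p))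
xor-cancelʳ false true  c p = ⊥-elim (Bₚ.not-¬ refl p)

-- Uniqueness of GF(2) polynomials, by induction on the number of variables: x₀ = 0 determines Q,
-- and cancelling Q from the value at x₀ = 1 determines P.
fH-injective : ∀ {n} (H G : Hypergraph n) → fH H ≗ fH G → H ≗ G
fH-injective {zero} H G eq [] = trans (sym (value H)) (trans (eq λ ()) (value G))
  where
  value : ∀ K → fH K (λ ()) ≡ K []
  value K = trans (Bₚ.xor-identityʳ _) (Bₚ.∧-identityʳ _)
fH-injective {suc n} H G eq = λ { (true ∷ E) → without⇒with E ; (false ∷ E) → without E }
  where
  eq₀ : fH (H ∘ (false ∷_)) ≗ fH (G ∘ (false ∷_))
  eq₀ a = trans (sym (fH-restrict₀ H a)) (trans (eq _) (fH-restrict₀ G a))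
  without : H ∘ (false ∷_) ≗ G ∘ (false ∷_)
  without = fH-injective _ _ eq₀
  without⇒with : H ∘ (true ∷_) ≗ G ∘ (true ∷_)
  without⇒with = fH-injective _ _ λ a → xor-cancelʳ _ _ (fH (H ∘ (false ∷_)) a) (begin
    fH (H ∘ (true ∷_)) a xor fH (H ∘ (false ∷_)) a ≡⟨ fH-restrict₁ H a ⟨
    fH H (consᶠ true a)                            ≡⟨ eq _ ⟩
    fH G (consᶠ true a)                            ≡⟨ fH-restrict₁ G a ⟩
    fH (G ∘ (true ∷_)) a xor fH (G ∘ (false ∷_)) a ≡⟨ cong (fH (G ∘ (true ∷_)) a xor_) (eq₀ a) ⟨
    fH (G ∘ (true ∷_)) a xor fH (H ∘ (false ∷_)) a ∎)

-- Uniqueness of the polynomial replaces a parity count over nested fibres: both sides represent the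
-- same substitution.
push-∘ : ∀ {n m o} (τ : Fin m → Fin o) (σ : Fin n → Fin m) H → push τ (push σ H) ≗ push (τ ∘ σ) H
push-∘ τ σ H = fH-injective _ _ λ a →
  trans (fH-push τ (push σ H) a) (trans (fH-push σ H (a ∘ τ)) (sym (fH-push (τ ∘ σ) H a)))

push-cong : ∀ {n m} {σ τ : Fin n → Fin m} {H G : Hypergraph n} → σ ≗ τ → H ≗ G → push σ H ≗ push τ G
push-cong {n} {σ = σ} {τ} {H} {G} eq eqH Y = ⨁-cong n λ E → cong₂ (λ b C → b ∧ (C ==ˢ Y)) (eqH E) (image-cong eq E)

push⁻ : ∀ {n m} (σ : Fin n → Fin m) H Y → push σ H Y ≡ true → ∃ λ E → H E ≡ true × image σ E ≡ Y
push⁻ {n} σ H Y p with E , q ← ⨁-true⁻ n _ p =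
  E , Bₚ.∧-conicalˡ (H E) _ q , ==ˢ⇒≡ _ _ (Bₚ.∧-conicalʳ (H E) _ q)

-- When no other edge has the same image, the sum has at most one nonzero term and nothing cancels
-- modulo 2.
push-image : ∀ {n m} (σ : Fin n → Fin m) (H : Hypergraph n) E →
             (∀ E′ → H E′ ≡ true → image σ E′ ≡ image σ E → E′ ≡ E) → push σ H (image σ E) ≡ H E
push-image σ H E unique = trans (⨁-single _ E off) on
  where
  off : ∀ E′ → E′ ≢ E → H E′ ∧ (image σ E′ ==ˢ image σ E) ≡ false
  off E′ ne with H E′ in h | image σ E′ ==ˢ image σ E in q
  ... | false | _     = refl
  ... | true  | false = refl
  ... | true  | true  = ⊥-elim (ne (unique E′ h (==ˢ⇒≡ _ _ q)))
  on : H E ∧ (image σ E ==ˢ image σ E) ≡ H E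
  on rewrite ==ˢ-refl (image σ E) = Bₚ.∧-identityʳ (H E)

image-injective : ∀ {n m} {φ : Fin n → Fin m} → Injective _≡_ _≡_ φ → ∀ {A B} → image φ A ≡ image φ B → A ≡ B
image-injective {φ = φ} inj {A} {B} eq = subset-ext λ x →
  trans (sym (∈-image-injective inj A x)) (trans (cong (φ x ∈ᵇ_) eq) (∈-image-injective inj B x))

push-injective : ∀ {n m} {φ : Fin n → Fin m} → Injective _≡_ _≡_ φ → ∀ H E → push φ H (image φ E) ≡ H E
push-injective inj H E = push-image _ H E λ E′ _ → image-injective inj

-- Isomorphisms

perm-injective : ∀ {n m} (π : Permutation n m) → Injective _≡_ _≡_ (π ⟨$⟩ʳ_)
perm-injective π {x} {y} eq = trans (sym (inverseˡ π)) (trans (cong (π ⟨$⟩ˡ_) eq) (inverseˡ π))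

image-flip : ∀ {n m} (π : Permutation n m) E → image (π ⟨$⟩ʳ_) (image (π ⟨$⟩ˡ_) E) ≡ E
image-flip π E = trans (image-∘ (π ⟨$⟩ʳ_) (π ⟨$⟩ˡ_) E) (trans (image-cong (λ _ → inverseʳ π) E) (image-id E))

module _ {n m} (H : Hypergraph n) (G : Hypergraph m) where

  IsIso : Permutation n m → Set
  IsIso π = ∀ E → H E ≡ G (image (π ⟨$⟩ʳ_) E)

  perm⇒≅ : ∀ π → IsIso π → H ≅ G
  perm⇒≅ π eq = ↔⇒⤖ π , eq

  ≅⇒perm : H ≅ G → Σ (Permutation n m) IsIso
  ≅⇒perm (φ , eq) = ⤖⇒↔ φ , eq

  push⇒≅ : ∀ π → push (π ⟨$⟩ʳ_) H ≗ G → H ≅ G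
  push⇒≅ π eq = perm⇒≅ π λ E → trans (sym (push-injective (perm-injective π) H E)) (eq _)

≗⇒≅ : ∀ {n} (H G : Hypergraph n) → H ≗ G → H ≅ G
≗⇒≅ H G eq = perm⇒≅ H G Perm.id λ E → trans (eq E) (cong G (sym (image-id E)))

IsIso-flip : ∀ {n m} (H : Hypergraph n) (G : Hypergraph m) π → IsIso H G π → IsIso G H (flip π)
IsIso-flip H G π eq E = trans (cong G (sym (image-flip π E))) (sym (eq _))

≅-sym : ∀ {n m} (H : Hypergraph n) (G : Hypergraph m) → H ≅ G → G ≅ H
≅-sym H G iso with π , eq ← ≅⇒perm H G iso = perm⇒≅ G H (flip π) (IsIso-flip H G π eq)

≅-trans : ∀ {n m o} (H : Hypergraph n) (G : Hypergraph m) (K : Hypergraph o) → H ≅ G → G ≅ K → H ≅ K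
≅-trans H G K iso₁ iso₂ with π , eq ← ≅⇒perm H G iso₁ | ρ , eq′ ← ≅⇒perm G K iso₂ =
  perm⇒≅ H K (π Perm.∘ₚ ρ) λ E → trans (eq E) (trans (eq′ _) (cong K (image-∘ (ρ ⟨$⟩ʳ_) (π ⟨$⟩ʳ_) E)))

-- Allows the two directions of an isomorphism to be proved separately, each by following edges
-- only.
IsIso-from-edges : ∀ {n m} (H : Hypergraph n) (G : Hypergraph m) π →
  (∀ E → H E ≡ true → G (image (π ⟨$⟩ʳ_) E) ≡ true) →
  (∀ E → G E ≡ true → H (image (π ⟨$⟩ˡ_) E) ≡ true) → IsIso H G π
IsIso-from-edges H G π f g E = ⇔⇒≡ (f E) λ p → trans (cong H (sym (image-flip (flip π) E))) (g _ p)

-- Contraction and deletion of a pair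

record Pair (n : ℕ) : Set where
  constructor pair
  field
    {i j} : Fin n
    i<j   : i F.< j

  i≢j : i ≢ j
  i≢j = Fₚ.<⇒≢ i<j

module Contraction {m} (e : Pair (suc m)) where
  open Pair e public

  l : Fin m
  l = punchOut {i = j} {j = i} (λ p → i≢j (sym p))

  h : Fin (suc m) → Fin m
  h = contractMap i j i<j

  punchIn-l : punchIn j l ≡ i
  punchIn-l = Fₚ.punchIn-punchOut _

  h-j : h j ≡ l
  h-j with j ≟ j
  ... | yes _ = refl
  ... | no ne = ⊥-elim (ne refl)

  h-punchIn : ∀ y → h (punchIn j y) ≡ y
  h-punchIn y with j ≟ punchIn j y
  ... | yes p = ⊥-elim (Fₚ.punchInᵢ≢i j y (sym p))
  ... | no ne = trans (Fₚ.punchOut-cong j refl) (Fₚ.punchOut-punchIn j)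

  h-i : h i ≡ l
  h-i = trans (cong h (sym punchIn-l)) (h-punchIn l)

  j-or-punchIn : ∀ x → x ≡ j ⊎ ∃ λ y → x ≡ punchIn j y
  j-or-punchIn x with j ≟ x
  ... | yes p = inj₁ (sym p)
  ... | no ne = inj₂ (punchOut ne , sym (Fₚ.punchIn-punchOut ne))

  contract≗push : ∀ H → contract H i j i<j ≗ push h H
  contract≗push H Y = trans (parity-filter (λ E → H E ∧ (image h E ==ˢ Y)) (allSubsets (suc m))) (xorSum-allSubsets (suc m) _)

  fH-contract : ∀ H a → fH (contract H i j i<j) a ≡ fH H (a ∘ h)
  fH-contract H a = trans (fH-≗ (contract≗push H) a) (fH-push h H a)

module Deletion {m} (e : Pair (suc (suc m))) where
  open Contraction e public

  emb : Fin m → Fin (suc (suc m))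
  emb = deleteEmb i j i<j

  emb-injective : ∀ {x y} → emb x ≡ emb y → x ≡ y
  emb-injective p = Fₚ.punchIn-injective l _ _ (Fₚ.punchIn-injective j _ _ p)

  emb≢j : ∀ {x} → emb x ≢ j
  emb≢j = Fₚ.punchInᵢ≢i j _

  emb≢i : ∀ {x} → emb x ≢ i
  emb≢i p = Fₚ.punchInᵢ≢i l _ (Fₚ.punchIn-injective j _ _ (trans p (sym punchIn-l)))

  h-emb : ∀ x → h (emb x) ≡ punchIn l x
  h-emb x = h-punchIn (punchIn l x)

  -- A view of the vertices, so that a case split on a vertex also rewrites it as `i`, `j` or a
  -- vertex of the deletion.
  data Position : Fin (suc (suc m)) → Set where
    at-i    : Position i
    at-j    : Position j
    outside : ∀ a → Position (emb a)

  position : ∀ x → Position x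
  position x with j-or-punchIn x
  ... | inj₁ refl = at-j
  ... | inj₂ (y , refl) with l ≟ y
  ...   | yes refl = subst Position (sym punchIn-l) at-i
  ...   | no ne = subst (Position ∘ punchIn j) (Fₚ.punchIn-punchOut ne) (outside (punchOut ne))

  position-outside : ∀ {x} → x ≢ i → x ≢ j → ∃ λ a → x ≡ emb a
  position-outside {x} x≢i x≢j with position x
  ... | at-i = ⊥-elim (x≢i refl)
  ... | at-j = ⊥-elim (x≢j refl)
  ... | outside a = a , refl

  Meets : Subset (suc (suc m)) → Set
  Meets E = i ∈ E ⊎ j ∈ E

  meets? : ∀ E → Dec (Meets E)
  meets? E = (i ∈? E) ⊎-dec (j ∈? E)

  subset-ext-outside : ∀ {A B} → ¬ Meets A → ¬ Meets B → (∀ a → (emb a ∈ᵇ A) ≡ (emb a ∈ᵇ B)) → A ≡ B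
  subset-ext-outside {A} {B} ¬A ¬B eq = subset-ext λ x → at (position x)
    where
    at : ∀ {x} → Position x → (x ∈ᵇ A) ≡ (x ∈ᵇ B)
    at at-i = trans (Bₚ.¬-not (¬A ∘ inj₁)) (sym (Bₚ.¬-not (¬B ∘ inj₁)))
    at at-j = trans (Bₚ.¬-not (¬A ∘ inj₂)) (sym (Bₚ.¬-not (¬B ∘ inj₂)))
    at (outside a) = eq a

  emb-∈ : ∀ X a → (emb a ∈ᵇ image emb X) ≡ (a ∈ᵇ X)
  emb-∈ = ∈-image-injective emb-injective

  emb-¬Meets : ∀ X → ¬ Meets (image emb X)
  emb-¬Meets X (inj₁ p) with _ , _ , q ← ∈-image⁻ emb X p = emb≢i q
  emb-¬Meets X (inj₂ p) with _ , _ , q ← ∈-image⁻ emb X p = emb≢j q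

  trace : Subset (suc (suc m)) → Subset m
  trace E = tabulate (λ a → emb a ∈ᵇ E)

  image-trace : ∀ E → ¬ Meets E → image emb (trace E) ≡ E
  image-trace E ¬E = subset-ext-outside (emb-¬Meets (trace E)) ¬E λ a → trans (emb-∈ (trace E) a) (Vₚ.lookup∘tabulate _ a)

  l∈image⁺ : ∀ E → Meets E → l ∈ image h E
  l∈image⁺ E (inj₁ p) = subst (_∈ image h E) h-i (∈-image⁺ h E p)
  l∈image⁺ E (inj₂ p) = subst (_∈ image h E) h-j (∈-image⁺ h E p)

  l∈image⁻ : ∀ E → l ∈ image h E → Meets E
  l∈image⁻ E p with x , x∈ , q ← ∈-image⁻ h E p | position x
  ... | at-i = inj₁ x∈
  ... | at-j = inj₂ x∈
  ... | outside a = ⊥-elim (Fₚ.punchInᵢ≢i l a (trans (sym (h-emb a)) q))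

  punchIn∈image : ∀ E a → (punchIn l a ∈ᵇ image h E) ≡ (emb a ∈ᵇ E)
  punchIn∈image E a = ⇔⇒≡ to (λ p → subst (_∈ image h E) (h-emb a) (∈-image⁺ h E p))
    where
    to : punchIn l a ∈ image h E → emb a ∈ E
    to p with x , x∈ , q ← ∈-image⁻ h E p | position x
    ... | at-i = ⊥-elim (Fₚ.punchInᵢ≢i l a (trans (sym q) h-i))
    ... | at-j = ⊥-elim (Fₚ.punchInᵢ≢i l a (trans (sym q) h-j))
    ... | outside b = subst (λ c → emb c ∈ E) (Fₚ.punchIn-injective l _ _ (trans (sym (h-emb b)) q)) x∈

  l-or-punchIn : ∀ y → y ≡ l ⊎ ∃ λ a → y ≡ punchIn l a
  l-or-punchIn y with l ≟ y
  ... | yes p = inj₁ (sym p)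
  ... | no ne = inj₂ (punchOut ne , sym (Fₚ.punchIn-punchOut ne))

-- Compatible bijections of contractions and deletions

insert-at : ∀ {m n} i j (π : Permutation m n) → insert i j π ⟨$⟩ʳ i ≡ j
insert-at i j π with i ≟ i
... | yes _ = refl
... | no ne = ⊥-elim (ne refl)

-- Contractions are compared by `φ` and deletions by `ψ`. Either bijection could be computed from
-- the other; keeping both makes the notion symmetric under `compatible-flip`.
record Compatible {m} (e e′ : Pair (suc (suc m))) : Set where
  private
    module A = Deletion e
    module B = Deletion e′
  field
    φ         : Permutation (suc m) (suc m)
    ψ         : Permutation m m
    φ-l       : φ ⟨$⟩ʳ A.l ≡ B.l
    φ-punchIn : ∀ a → φ ⟨$⟩ʳ punchIn A.l a ≡ punchIn B.l (ψ ⟨$⟩ʳ a)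

compatible-flip : ∀ {m} {e e′ : Pair (suc (suc m))} → Compatible e e′ → Compatible e′ e
compatible-flip {e = e} {e′} C = record
  { φ = flip φ
  ; ψ = flip ψ
  ; φ-l = trans (cong (φ ⟨$⟩ˡ_) (sym φ-l)) (inverseˡ φ)
  ; φ-punchIn = λ b → trans (cong (φ ⟨$⟩ˡ_) (trans (cong (punchIn _) (sym (inverseʳ ψ))) (sym (φ-punchIn _)))) (inverseˡ φ)
  }
  where open Compatible C

compatible-insert : ∀ {m} (e e′ : Pair (suc (suc m))) → Permutation m m → Compatible e e′
compatible-insert e e′ ψ = record
  { φ = insert A.l B.l ψ
  ; ψ = ψ
  ; φ-l = insert-at A.l B.l ψ
  ; φ-punchIn = insert-punchIn A.l B.l ψ
  }
  where
  module A = Deletion e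
  module B = Deletion e′

-- Entry point for an isomorphism of contractions, once it is known to respect the new vertices;
-- `compatible-insert` serves isomorphisms of deletions.
compatible-remove : ∀ {m} (e e′ : Pair (suc (suc m))) (φ : Permutation (suc m) (suc m)) →
                    φ ⟨$⟩ʳ Deletion.l e ≡ Deletion.l e′ → Compatible e e′
compatible-remove e e′ φ eq = record
  { φ = φ
  ; ψ = remove (Deletion.l e) φ
  ; φ-l = eq
  ; φ-punchIn = λ a → trans (punchIn-permute φ (Deletion.l e) a) (cong (λ z → punchIn z (remove (Deletion.l e) φ ⟨$⟩ʳ a)) eq)
  }

-- Linear spaces and corresponding edges

record LinearSpace {n} (H : Hypergraph n) : Set where
  field
    line   : ∀ {x y} → x ≢ y → ∃ λ E → H E ≡ true × x ∈ E × y ∈ E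
    unique : ∀ {x y E E′} → x ≢ y → H E ≡ true → H E′ ≡ true → x ∈ E → y ∈ E → x ∈ E′ → y ∈ E′ → E ≡ E′

-- The form in which `3 ≤ k` enters. In `third` the points `a` and `b` may coincide or lie off the
-- edge, so the field also produces first and second points.
record ThickLinearSpace {n} (H : Hypergraph n) : Set where
  field
    linear : LinearSpace H
    third  : ∀ {E} → H E ≡ true → ∀ a b → ∃ λ x → x ∈ E × x ≢ a × x ≢ b
  open LinearSpace linear public

module Corresponding {m} {e e′ : Pair (suc (suc m))} (C : Compatible e e′) where
  open Compatible C
  private
    module A = Deletion e
    module B = Deletion e′

  record Corr (E E′ : Subset (suc (suc m))) : Set where
    constructor corr
    field
      meets⁺  : A.Meets E → B.Meets E′
      meets⁻  : B.Meets E′ → A.Meets E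
      outside : ∀ a → (A.emb a ∈ᵇ E) ≡ (B.emb (ψ ⟨$⟩ʳ a) ∈ᵇ E′)

  -- Corr E E′ is an unfolded form of image B.h E′ ≡ image φ (image A.h E).

  corr⇒image : ∀ {E E′} → Corr E E′ → image B.h E′ ≡ image (φ ⟨$⟩ʳ_) (image A.h E)
  corr⇒image {E} {E′} c = subset-ext λ y →
    -- Every vertex of the target is a value of `φ`, so it suffices to compare at `φ` of the new
    -- vertex and at `φ` of an old one.
    subst (λ z → (z ∈ᵇ image B.h E′) ≡ (z ∈ᵇ image (φ ⟨$⟩ʳ_) (image A.h E))) (inverseʳ φ) (at (A.l-or-punchIn (φ ⟨$⟩ˡ y)))
    where
    open Corr c
    at : ∀ {x} → x ≡ A.l ⊎ (∃ λ a → x ≡ punchIn A.l a) →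
         ((φ ⟨$⟩ʳ x) ∈ᵇ image B.h E′) ≡ ((φ ⟨$⟩ʳ x) ∈ᵇ image (φ ⟨$⟩ʳ_) (image A.h E))
    at {x} (inj₁ refl) = begin
      (φ ⟨$⟩ʳ A.l) ∈ᵇ image B.h E′ ≡⟨ cong (_∈ᵇ image B.h E′) φ-l ⟩
      B.l ∈ᵇ image B.h E′          ≡⟨ ⇔⇒≡ (A.l∈image⁺ E ∘ meets⁻ ∘ B.l∈image⁻ E′) (B.l∈image⁺ E′ ∘ meets⁺ ∘ A.l∈image⁻ E) ⟩
      A.l ∈ᵇ image A.h E           ≡⟨ ∈-image-injective (perm-injective φ) (image A.h E) A.l ⟨
      (φ ⟨$⟩ʳ A.l) ∈ᵇ image (φ ⟨$⟩ʳ_) (image A.h E) ∎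
    at {x} (inj₂ (a , refl)) = begin
      (φ ⟨$⟩ʳ x) ∈ᵇ image B.h E′              ≡⟨ cong (_∈ᵇ image B.h E′) (φ-punchIn a) ⟩
      punchIn B.l (ψ ⟨$⟩ʳ a) ∈ᵇ image B.h E′  ≡⟨ B.punchIn∈image E′ _ ⟩
      B.emb (ψ ⟨$⟩ʳ a) ∈ᵇ E′                  ≡⟨ outside a ⟨
      A.emb a ∈ᵇ E                            ≡⟨ A.punchIn∈image E a ⟨
      x ∈ᵇ image A.h E                        ≡⟨ ∈-image-injective (perm-injective φ) (image A.h E) x ⟨
      (φ ⟨$⟩ʳ x) ∈ᵇ image (φ ⟨$⟩ʳ_) (image A.h E) ∎

  image⇒corr : ∀ {E E′} → image B.h E′ ≡ image (φ ⟨$⟩ʳ_) (image A.h E) → Corr E E′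
  image⇒corr {E} {E′} eq = corr
    (λ p → B.l∈image⁻ E′ (trans (sym at-l) (A.l∈image⁺ E p)))
    (λ p → A.l∈image⁻ E (trans at-l (B.l∈image⁺ E′ p)))
    (λ a → begin
      A.emb a ∈ᵇ E                                             ≡⟨ A.punchIn∈image E a ⟨
      punchIn A.l a ∈ᵇ image A.h E                             ≡⟨ shift (punchIn A.l a) ⟩
      (φ ⟨$⟩ʳ punchIn A.l a) ∈ᵇ image B.h E′                   ≡⟨ cong (_∈ᵇ image B.h E′) (φ-punchIn a) ⟩
      punchIn B.l (ψ ⟨$⟩ʳ a) ∈ᵇ image B.h E′                   ≡⟨ B.punchIn∈image E′ _ ⟩
      B.emb (ψ ⟨$⟩ʳ a) ∈ᵇ E′ ∎)
    where
    shift : ∀ x → (x ∈ᵇ image A.h E) ≡ ((φ ⟨$⟩ʳ x) ∈ᵇ image B.h E′)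
    shift x = trans (sym (∈-image-injective (perm-injective φ) (image A.h E) x)) (cong ((φ ⟨$⟩ʳ x) ∈ᵇ_) (sym eq))
    at-l : (A.l ∈ᵇ image A.h E) ≡ (B.l ∈ᵇ image B.h E′)
    at-l = trans (shift A.l) (cong (_∈ᵇ image B.h E′) φ-l)

open Corresponding using (Corr; corr)

corr-flip : ∀ {m} {e e′ : Pair (suc (suc m))} (C : Compatible e e′) {E E′} → Corr (compatible-flip C) E′ E → Corr C E E′
corr-flip {e = e} {e′} C {E} {E′} c = corr (meets⁻) (meets⁺) λ a →
  trans (cong (λ z → Deletion.emb e z ∈ᵇ E) (sym (inverseˡ ψ))) (sym (outside (ψ ⟨$⟩ʳ a)))
  where
  open Compatible C
  open Corr c

-- Edges of contractions and deletions

module Contracting {n} {H : Hypergraph (suc (suc n))} (T : ThickLinearSpace H) (e : Pair (suc (suc n))) where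
  open ThickLinearSpace T
  open Deletion e

  contracted : Hypergraph (suc n)
  contracted = contract H i j i<j

  deleted : Hypergraph n
  deleted = delete H i j i<j

  private
    avoid : ∀ {E} → H E ≡ true → ∀ d → (∀ {z} → z ∈ E → z ≢ d → z ≢ i × z ≢ j) → ∃₂ λ a b → a ≢ b × emb a ∈ E × emb b ∈ E
    avoid {E} hE d f with x , x∈ , x≢d , _ ← third hE d d with y , y∈ , y≢x , y≢d ← third hE x d
      with x≢i , x≢j ← f x∈ x≢d | y≢i , y≢j ← f y∈ y≢d
      with a , refl ← position-outside x≢i x≢j | b , refl ← position-outside y≢i y≢j =
      a , b , (λ { refl → y≢x refl }) , x∈ , y∈

  -- An edge that does not contain both `i` and `j` loses at most one point to the pair; thickness
  -- leaves two others.
  two-outside : ∀ {E} → H E ≡ true → (i ∈ E × j ∈ E) ⊎ (∃₂ λ a b → a ≢ b × emb a ∈ E × emb b ∈ E)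
  two-outside {E} hE with i ∈? E | j ∈? E
  ... | yes p | yes q = inj₁ (p , q)
  ... | no ¬p | _     = inj₂ (avoid hE j λ z∈ z≢j → (λ { refl → ¬p z∈ }) , z≢j)
  ... | yes _ | no ¬q = inj₂ (avoid hE i λ z∈ z≢i → z≢i , λ { refl → ¬q z∈ })

  same-outside : ∀ {E E′} → image h E ≡ image h E′ → ∀ {a} → emb a ∈ E → emb a ∈ E′
  same-outside {E} {E′} eq {a} p = trans (sym (punchIn∈image E′ a)) (trans (cong (punchIn l a ∈ᵇ_) (sym eq)) (trans (punchIn∈image E a) p))

  -- The image remembers all points outside the pair. Two such points determine the edge; if neither
  -- edge has two, both are the line through `i` and `j`.
  h-injective-on-edges : ∀ {E E′} → H E ≡ true → H E′ ≡ true → image h E ≡ image h E′ → E ≡ E′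
  h-injective-on-edges {E} {E′} hE hE′ eq with two-outside hE | two-outside hE′
  ... | inj₁ (p , q) | inj₁ (p′ , q′) = unique i≢j hE hE′ p q p′ q′
  ... | inj₂ (a , b , a≢b , p , q) | _ =
    unique (a≢b ∘ emb-injective) hE hE′ p q (same-outside {E} {E′} eq p) (same-outside {E} {E′} eq q)
  ... | inj₁ _ | inj₂ (a , b , a≢b , p , q) =
    unique (a≢b ∘ emb-injective) hE hE′ (same-outside {E′} {E} (sym eq) p) (same-outside {E′} {E} (sym eq) q) p q

  -- By injectivity on edges there is no cancellation modulo 2.
  contracted⁺ : ∀ {E} → H E ≡ true → contracted (image h E) ≡ true
  contracted⁺ {E} hE = trans (contract≗push H (image h E)) (trans (push-image h H E λ E′ hE′ → h-injective-on-edges hE′ hE) hE)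

  contracted⁻ : ∀ {Y} → contracted Y ≡ true → ∃ λ E → H E ≡ true × image h E ≡ Y
  contracted⁻ {Y} p = push⁻ h H Y (trans (sym (contract≗push H Y)) p)

module Transfer {n} {H : Hypergraph (suc (suc n))} (T : ThickLinearSpace H)
                {e e′ : Pair (suc (suc n))} (C : Compatible e e′) where
  open Compatible C
  open Corresponding C hiding (Corr; corr)
  private
    module A = Deletion e
    module B = Deletion e′
    module AH = Contracting T e
    module BH = Contracting T e′

  -- The first two are halves of isomorphisms; the other halves are the same types at
  -- `compatible-flip C`. The last two lift them to edges of `H`, where uniqueness of lines is
  -- available.
  ContractedMap DeletedMap EdgeMap OutsideEdgeMap : Set
  ContractedMap  = ∀ Y → AH.contracted Y ≡ true → BH.contracted (image (φ ⟨$⟩ʳ_) Y) ≡ true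
  DeletedMap     = ∀ X → AH.deleted X ≡ true → BH.deleted (image (ψ ⟨$⟩ʳ_) X) ≡ true
  EdgeMap        = ∀ {E} → H E ≡ true → ∃ λ E′ → H E′ ≡ true × Corr C E E′
  OutsideEdgeMap = ∀ {E} → H E ≡ true → ¬ A.Meets E → ∃ λ E′ → H E′ ≡ true × Corr C E E′

  edges⇒contracted : EdgeMap → ContractedMap
  edges⇒contracted f Y p with E , hE , refl ← AH.contracted⁻ p with E′ , hE′ , c ← f hE =
    trans (cong BH.contracted (sym (corr⇒image {E} {E′} c))) (BH.contracted⁺ hE′)

  contracted⇒edges : ContractedMap → EdgeMap
  contracted⇒edges f {E} hE =
    let E′ , hE′ , eq = BH.contracted⁻ {image (φ ⟨$⟩ʳ_) (image A.h E)} (f (image A.h E) (AH.contracted⁺ hE))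
    in E′ , hE′ , image⇒corr {E} {E′} eq

  corr-image : ∀ X → Corr C (image A.emb X) (image B.emb (image (ψ ⟨$⟩ʳ_) X))
  corr-image X = corr (⊥-elim ∘ A.emb-¬Meets X) (⊥-elim ∘ B.emb-¬Meets (image (ψ ⟨$⟩ʳ_) X)) λ a →
    trans (A.emb-∈ X a) (trans (sym (∈-image-injective (perm-injective ψ) X a)) (sym (B.emb-∈ (image (ψ ⟨$⟩ʳ_) X) _)))

  corr-unique : ∀ {E E′ E″} → ¬ A.Meets E → Corr C E E′ → Corr C E E″ → E′ ≡ E″
  corr-unique {E} {E′} {E″} ¬E c d = B.subset-ext-outside (¬E ∘ Corr.meets⁻ c) (¬E ∘ Corr.meets⁻ d) λ b →
    subst (λ z → (B.emb z ∈ᵇ E′) ≡ (B.emb z ∈ᵇ E″)) (inverseʳ ψ) (trans (sym (Corr.outside c _)) (Corr.outside d _))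

  edges⇒deleted : OutsideEdgeMap → DeletedMap
  edges⇒deleted f X p with E′ , hE′ , c ← f p (A.emb-¬Meets X) =
    -- An edge avoiding the pair has only one corresponding set, so the edge supplied by `f` is the
    -- required image.
    trans (cong H (corr-unique (A.emb-¬Meets X) (corr-image X) c)) hE′

  deleted⇒edges : DeletedMap → OutsideEdgeMap
  deleted⇒edges f {E} hE ¬E = image B.emb (image (ψ ⟨$⟩ʳ_) (A.trace E)) , f (A.trace E) (trans (cong H (A.image-trace E ¬E)) hE) ,
    subst (λ Z → Corr C Z (image B.emb (image (ψ ⟨$⟩ʳ_) (A.trace E)))) (A.image-trace E ¬E) (corr-image (A.trace E))

-- Deletions determine contractions

module Adjacency {n} {H : Hypergraph (suc (suc n))} (T : ThickLinearSpace H) (e : Pair (suc (suc n))) where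
  open ThickLinearSpace T
  open Deletion e
  open Contracting T e using (two-outside)

  E₀ : Subset (suc (suc n))
  E₀ = proj₁ (line i≢j)

  E₀-edge : H E₀ ≡ true
  E₀-edge = proj₁ (proj₂ (line i≢j))

  i∈E₀ : i ∈ E₀
  i∈E₀ = proj₁ (proj₂ (proj₂ (line i≢j)))

  j∈E₀ : j ∈ E₀
  j∈E₀ = proj₂ (proj₂ (proj₂ (line i≢j)))

  ≡E₀ : ∀ {E} → H E ≡ true → i ∈ E → j ∈ E → E ≡ E₀
  ≡E₀ hE p q = unique i≢j hE E₀-edge p q i∈E₀ j∈E₀

  meets-E₀ : ∀ {E a} → H E ≡ true → Meets E → emb a ∈ E → emb a ∈ E₀ → E ≡ E₀
  meets-E₀ hE (inj₁ p) q r = unique emb≢i hE E₀-edge q p r i∈E₀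
  meets-E₀ hE (inj₂ p) q r = unique emb≢j hE E₀-edge q p r j∈E₀

  -- The positive form of non-collinearity in the deletion: instead of the absence of an edge there,
  -- it records the line of `H` that was destroyed.
  record Adj (a b : Fin n) : Set where
    constructor adj
    field
      a≢b   : a ≢ b
      {edge} : Subset (suc (suc n))
      isEdge : H edge ≡ true
      left   : emb a ∈ edge
      right  : emb b ∈ edge
      meets  : Meets edge

  -- By pigeonhole two of the three lines ab, ac, bc share a point of e; as they also share a
  -- vertex outside e, they coincide.
  triangle : ∀ {a b c E} → Adj a b → Adj a c → Adj b c → H E ≡ true → emb a ∈ E → emb b ∈ E → emb c ∈ E
  triangle {a} {b} {c} {E} (adj a≢b {E₁} h₁ a₁ b₁ m₁) (adj a≢c {E₂} h₂ a₂ c₂ m₂) (adj b≢c {E₃} h₃ b₃ c₃ m₃) hE a∈ b∈ =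
    subst (emb c ∈_) (unique (a≢b ∘ emb-injective) h₁ hE a₁ b₁ a∈ b∈) (via m₁ m₂ m₃)
    where
    E₂≡E₁ : emb b ∈ E₂ → E₂ ≡ E₁
    E₂≡E₁ b₂ = unique (a≢b ∘ emb-injective) h₂ h₁ a₂ b₂ a₁ b₁
    same₁₂ : ∀ {s} → (∀ {x} → emb x ≢ s) → s ∈ E₁ → s ∈ E₂ → emb c ∈ E₁
    same₁₂ ne p q = subst (emb c ∈_) (unique ne h₂ h₁ a₂ q a₁ p) c₂
    same₁₃ : ∀ {s} → (∀ {x} → emb x ≢ s) → s ∈ E₁ → s ∈ E₃ → emb c ∈ E₁
    same₁₃ ne p q = subst (emb c ∈_) (unique ne h₃ h₁ b₃ q b₁ p) c₃
    -- Here the lines ac and bc coincide first; so ac contains b and is the line ab.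
    same₂₃ : ∀ {s} → (∀ {x} → emb x ≢ s) → s ∈ E₂ → s ∈ E₃ → emb c ∈ E₁
    same₂₃ ne p q = subst (emb c ∈_) (E₂≡E₁ (subst (emb b ∈_) (unique ne h₃ h₂ c₃ q c₂ p) b₃)) c₂
    via : Meets E₁ → Meets E₂ → Meets E₃ → emb c ∈ E₁
    via (inj₁ p) (inj₁ q) _        = same₁₂ emb≢i p q
    via (inj₂ p) (inj₂ q) _        = same₁₂ emb≢j p q
    via (inj₁ p) (inj₂ q) (inj₁ r) = same₁₃ emb≢i p r
    via (inj₁ p) (inj₂ q) (inj₂ r) = same₂₃ emb≢j q r
    via (inj₂ p) (inj₁ q) (inj₁ r) = same₂₃ emb≢i q r
    via (inj₂ p) (inj₁ q) (inj₂ r) = same₁₃ emb≢j p r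

  -- A line through a point of `E₀` outside the pair that also meets the pair shares two points with
  -- `E₀`. Hence all neighbours of `a` lie on `E₀`.
  E₀-neighbours : ∀ {a b c} → emb a ∈ E₀ → Adj a b → Adj a c → b ≢ c → Adj b c
  E₀-neighbours a∈ ab ac b≢c = adj b≢c E₀-edge (in-E₀ ab) (in-E₀ ac) (inj₁ i∈E₀)
    where
    in-E₀ : ∀ {b} → Adj _ b → emb b ∈ E₀
    in-E₀ {b} (adj _ h a∈′ b∈ m) = subst (emb b ∈_) (meets-E₀ h m a∈′ a∈) b∈

  Fork : Fin n → Set
  Fork a = ∃₂ λ b c → Adj a b × Adj a c × b ≢ c × ¬ Adj b c

  -- The lines from `a` to `i` and to `j` differ. Third points b and c on them are neighbours of
  -- `a`; if they were adjacent, `triangle` would put c on the first line, and both lines would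
  -- become `E₀`.
  ∉E₀⇒fork : ∀ {a} → emb a ∉ E₀ → Fork a
  ∉E₀⇒fork {a} a∉
    with L₁ , h₁ , i₁ , a₁ ← line {i} {emb a} (emb≢i ∘ sym)
       | L₂ , h₂ , j₂ , a₂ ← line {j} {emb a} (emb≢j ∘ sym)
    with x , x₁ , x≢i , x≢a ← third h₁ i (emb a)
       | y , y₂ , y≢j , y≢a ← third h₂ j (emb a)
    -- A third point equal to the other element of the pair would make the line `E₀`, which misses
    -- `emb a`.
    with b , refl ← position-outside x≢i (λ { refl → a∉ (subst (emb a ∈_) (≡E₀ h₁ i₁ x₁) a₁) })
       | c , refl ← position-outside (λ { refl → a∉ (subst (emb a ∈_) (≡E₀ h₂ y₂ j₂) a₂) }) y≢j =
    b , c , ab , ac , (λ { refl → c∉L₁ x₁ }) , λ bc → c∉L₁ (triangle ab ac bc h₁ a₁ x₁)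
    where
    ab = adj (λ { refl → x≢a refl }) h₁ a₁ x₁ (inj₁ i₁)
    ac = adj (λ { refl → y≢a refl }) h₂ a₂ y₂ (inj₂ j₂)
    c∉L₁ : emb c ∉ L₁
    c∉L₁ c₁ = a∉ (subst (emb a ∈_) (≡E₀ h₁ i₁ (subst (j ∈_) (sym L₁≡L₂) j₂)) a₁)
      where
      L₁≡L₂ = unique y≢a h₁ h₂ c₁ a₁ y₂ a₂

  two-outside-or-E₀ : ∀ {E} → H E ≡ true → E ≡ E₀ ⊎ (∃₂ λ a b → a ≢ b × emb a ∈ E × emb b ∈ E)
  two-outside-or-E₀ hE with two-outside hE
  ... | inj₁ (p , q) = inj₁ (≡E₀ hE p q)
  ... | inj₂ ab = inj₂ ab

module AdjacencyMap {n} {H : Hypergraph (suc (suc n))} (T : ThickLinearSpace H)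
                    {e e′ : Pair (suc (suc n))} (C : Compatible e e′)
                    (back : Transfer.OutsideEdgeMap T (compatible-flip C)) where
  open ThickLinearSpace T
  open Compatible C
  private
    module A = Deletion e
    module B = Deletion e′
    module AA = Adjacency T e
    module BA = Adjacency T e′

  -- If the line through the two images avoided the second pair, `back` would turn it into an edge
  -- through `a` and `b` avoiding the first pair, contrary to uniqueness of their line.
  adj-map : ∀ {a b} → AA.Adj a b → BA.Adj (ψ ⟨$⟩ʳ a) (ψ ⟨$⟩ʳ b)
  adj-map {a} {b} (AA.adj a≢b h p q m) with E′ , h′ , p′ , q′ ← line {B.emb (ψ ⟨$⟩ʳ a)} {B.emb (ψ ⟨$⟩ʳ b)} (a≢b ∘ perm-injective ψ ∘ B.emb-injective)
    with B.meets? E′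
  ... | yes m′ = BA.adj (a≢b ∘ perm-injective ψ) h′ p′ q′ m′
  ... | no ¬m′ with E , hE , c ← back h′ ¬m′ with c′ ← corr-flip C c =
    ⊥-elim (¬m′ (Corr.meets⁺ c′ (subst A.Meets (unique (a≢b ∘ A.emb-injective) h hE p q (at a p′) (at b q′)) m)))
    where
    at : ∀ a → B.emb (ψ ⟨$⟩ʳ a) ∈ E′ → A.emb a ∈ E
    at a r = trans (Corr.outside c′ a) r

module Extension {n} {H : Hypergraph (suc (suc n))} (T : ThickLinearSpace H)
                 {e e′ : Pair (suc (suc n))} (C : Compatible e e′)
                 (forth : Transfer.OutsideEdgeMap T C)
                 (back : Transfer.OutsideEdgeMap T (compatible-flip C)) where
  open ThickLinearSpace T
  open Compatible C
  private
    module A = Deletion e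
    module B = Deletion e′
    module AA = Adjacency T e
    module BA = Adjacency T e′

  -- The double flip carries other proofs than `C`, so its `Corr` is a different type; the fields
  -- agree and are repackaged.
  forth′ : Transfer.OutsideEdgeMap T (compatible-flip (compatible-flip C))
  forth′ hE ¬m = let E′ , hE′ , c = forth hE ¬m in
    E′ , hE′ , corr (Corr.meets⁺ c) (Corr.meets⁻ c) (Corr.outside c)

  open AdjacencyMap T C back
  open AdjacencyMap T (compatible-flip C) forth′ using () renaming (adj-map to adj-map-flip)

  adj-map⁻ : ∀ {a b} → BA.Adj (ψ ⟨$⟩ʳ a) (ψ ⟨$⟩ʳ b) → AA.Adj a b
  adj-map⁻ {a} {b} p = subst (λ z → AA.Adj z b) (inverseˡ ψ) (subst (AA.Adj _) (inverseˡ ψ) (adj-map-flip p))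

  -- A fork at the image would pull back to two neighbours of `a`. These are adjacent because `a`
  -- lies on `E₀`, and mapping that adjacency forward contradicts the fork.
  E₀-map : ∀ {a} → A.emb a ∈ AA.E₀ → B.emb (ψ ⟨$⟩ʳ a) ∈ BA.E₀
  E₀-map {a} a∈ with B.emb (ψ ⟨$⟩ʳ a) ∈? BA.E₀
  ... | yes p = p
  ... | no ¬p with b , c , ab , ac , b≢c , ¬bc ← BA.∉E₀⇒fork ¬p =
    ⊥-elim (¬bc (subst (λ z → BA.Adj z c) (inverseʳ ψ) (subst (BA.Adj _) (inverseʳ ψ)
      (adj-map (AA.E₀-neighbours a∈ (pull ab) (pull ac) λ eq → b≢c (perm-injective (flip ψ) eq))))))
    where
    pull : ∀ {b} → BA.Adj (ψ ⟨$⟩ʳ a) b → AA.Adj a (ψ ⟨$⟩ˡ b)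
    pull p = adj-map⁻ (subst (BA.Adj (ψ ⟨$⟩ʳ a)) (sym (inverseʳ ψ)) p)

  -- The partner is the line through the images of `a` and `b`. Any further outside point of either
  -- line is adjacent to both base points, hence so is its counterpart, and `triangle` puts that
  -- counterpart on the other line.
  block-corr : ∀ {E a b} → H E ≡ true → A.Meets E → a ≢ b → A.emb a ∈ E → A.emb b ∈ E → ∃ λ E′ → H E′ ≡ true × Corr C E E′
  block-corr {E} {a} {b} hE m a≢b a∈ b∈ = E′ , hE′ , corr (λ _ → m′) (λ _ → m) λ c → ⇔⇒≡ (to c) (from c)
    where
    ab = AA.adj a≢b hE a∈ b∈ m
    ab′ = adj-map ab
    open BA.Adj ab′ renaming (edge to E′; isEdge to hE′; left to a∈′; right to b∈′; meets to m′; a≢b to a≢b′)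
    to : ∀ c → A.emb c ∈ E → B.emb (ψ ⟨$⟩ʳ c) ∈ E′
    -- The base points are split off because adjacency requires distinct vertices.
    to c c∈ with a ≟ c | b ≟ c
    ... | yes refl | _ = a∈′
    ... | no _ | yes refl = b∈′
    ... | no a≢c | no b≢c = BA.triangle ab′ (adj-map (AA.adj a≢c hE a∈ c∈ m)) (adj-map (AA.adj b≢c hE b∈ c∈ m)) hE′ a∈′ b∈′
    from : ∀ c → B.emb (ψ ⟨$⟩ʳ c) ∈ E′ → A.emb c ∈ E
    from c c∈ with a ≟ c | b ≟ c
    ... | yes refl | _ = a∈
    ... | no _ | yes refl = b∈
    ... | no a≢c | no b≢c = AA.triangle ab (adj-map⁻ (BA.adj (a≢c ∘ perm-injective ψ) hE′ a∈′ c∈ m′))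
                              (adj-map⁻ (BA.adj (b≢c ∘ perm-injective ψ) hE′ b∈′ c∈ m′)) hE a∈ b∈

module _ {n} {H : Hypergraph (suc (suc n))} (T : ThickLinearSpace H) where

  -- An edge avoids the pair, or meets it and has two outside points, or is `E₀`. The last needs
  -- `E₀-map`, since `E₀` may have fewer than two outside points, as it does for k = 3.
  extend : ∀ {e e′ : Pair (suc (suc n))} (C : Compatible e e′) → Transfer.OutsideEdgeMap T C → Transfer.OutsideEdgeMap T (compatible-flip C) →
           Transfer.EdgeMap T C
  extend {e} {e′} C forth back {E} hE with Deletion.meets? e E
  ... | no ¬m = forth hE ¬m
  ... | yes m with Adjacency.two-outside-or-E₀ T e hE
  ...   | inj₂ (a , b , a≢b , a∈ , b∈) = Extension.block-corr T C forth back hE m a≢b a∈ b∈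
  ...   | inj₁ refl = BA.E₀ , BA.E₀-edge , corr (λ _ → inj₁ BA.i∈E₀) (λ _ → inj₁ (Adjacency.i∈E₀ T e)) λ a → ⇔⇒≡ X.E₀-map
          λ p → subst (λ z → Deletion.emb e z ∈ Adjacency.E₀ T e) (inverseˡ (Compatible.ψ C)) (Y.E₀-map p)
    where
    module BA = Adjacency T e′
    module X = Extension T C forth back
    module Y = Extension T (compatible-flip C) back X.forth′

  deleted≅⇒contracted≅ : ∀ e e′ → Contracting.deleted T e ≅ Contracting.deleted T e′ → Contracting.contracted T e ≅ Contracting.contracted T e′
  deleted≅⇒contracted≅ e e′ iso with ψ , eq ← ≅⇒perm (Contracting.deleted T e) (Contracting.deleted T e′) iso =
    perm⇒≅ G G′ (Compatible.φ C) (IsIso-from-edges G G′ (Compatible.φ C)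
      (Transfer.edges⇒contracted T C (extend C forth back))
      (Transfer.edges⇒contracted T C′ (extend C′ back (Extension.forth′ T C forth back))))
    where
    G = Contracting.contracted T e
    G′ = Contracting.contracted T e′
    C = compatible-insert e e′ ψ
    C′ = compatible-flip C
    forth : Transfer.OutsideEdgeMap T C
    forth = Transfer.deleted⇒edges T C λ X p → trans (sym (eq X)) p
    back : Transfer.OutsideEdgeMap T C′
    back = Transfer.deleted⇒edges T C′ λ X p → trans (sym (IsIso-flip (Contracting.deleted T e) (Contracting.deleted T e′) ψ eq X)) p

-- Contractions determine deletions

module DoublePairs {n} {H : Hypergraph (suc (suc n))} (T : ThickLinearSpace H) (e : Pair (suc (suc n))) where
  open ThickLinearSpace T
  open Deletion e
  open Contracting T e
  open Adjacency T e using (E₀; E₀-edge; i∈E₀; j∈E₀; ≡E₀)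

  -- Formulated through the edges of the contraction alone, without mention of `l`, so that
  -- isomorphisms preserve it.
  record DoublePair (u v : Fin (suc n)) : Set where
    constructor doublePair
    field
      u≢v     : u ≢ v
      {Y Y′}  : Subset (suc n)
      Y≢Y′    : Y ≢ Y′
      isEdge  : contracted Y ≡ true
      isEdge′ : contracted Y′ ≡ true
      u∈Y     : u ∈ Y
      v∈Y     : v ∈ Y
      u∈Y′    : u ∈ Y′
      v∈Y′    : v ∈ Y′

  -- Two edges through two old vertices come from lines of `H` sharing two points, so they are
  -- equal.
  doublePair⇒l : ∀ {u v} → DoublePair u v → u ≡ l ⊎ v ≡ l
  doublePair⇒l {u} {v} (doublePair u≢v {Y} {Y′} Y≢Y′ cY cY′ u∈Y v∈Y u∈Y′ v∈Y′) = by (l-or-punchIn u) (l-or-punchIn v)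
    where
    by : u ≡ l ⊎ (∃ λ a → u ≡ punchIn l a) → v ≡ l ⊎ (∃ λ b → v ≡ punchIn l b) → u ≡ l ⊎ v ≡ l
    by (inj₁ p) _ = inj₁ p
    by (inj₂ _) (inj₁ q) = inj₂ q
    by (inj₂ (a , refl)) (inj₂ (b , refl)) =
      let E , hE , p = contracted⁻ {Y} cY
          E′ , hE′ , p′ = contracted⁻ {Y′} cY′
          at : ∀ {c E Y} → image h E ≡ Y → punchIn l c ∈ Y → emb c ∈ E
          at {c} {E} eq q = trans (sym (punchIn∈image E c)) (trans (cong (punchIn l c ∈ᵇ_) eq) q)
          E≡E′ = unique (λ eq → u≢v (cong (punchIn l) (emb-injective eq))) hE hE′
                   (at {a} {E} p u∈Y) (at {b} {E} p v∈Y) (at {a} {E′} p′ u∈Y′) (at {b} {E′} p′ v∈Y′)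
      in ⊥-elim (Y≢Y′ (trans (sym p) (trans (cong (image h) E≡E′) p′)))

  -- The lines from `a` to `i` and to `j` are distinct, remain distinct under contraction, and both
  -- pass through `l`.
  outside-E₀⇒doublePair : ∀ {a} → emb a ∉ E₀ → DoublePair l (punchIn l a)
  outside-E₀⇒doublePair {a} a∉ =
    let L₁ , h₁ , i₁ , a₁ = line {i} {emb a} (emb≢i ∘ sym)
        L₂ , h₂ , j₂ , a₂ = line {j} {emb a} (emb≢j ∘ sym)
    in doublePair (Fₚ.punchInᵢ≢i l a ∘ sym) {image h L₁} {image h L₂}
         (λ eq → a∉ (subst (emb a ∈_) (≡E₀ h₁ i₁ (subst (j ∈_) (sym (h-injective-on-edges h₁ h₂ eq)) j₂)) a₁))
         (contracted⁺ h₁) (contracted⁺ h₂)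
         (l∈image⁺ L₁ (inj₁ i₁)) (trans (punchIn∈image L₁ a) a₁)
         (l∈image⁺ L₂ (inj₂ j₂)) (trans (punchIn∈image L₂ a) a₂)

  -- A star with a single leaf does not reveal its centre, so a second leaf is needed. It is a third
  -- point on the line from `i` to the first, which meets `E₀` only in `i`.
  two-outside-E₀ : ∀ {x} → x ∉ E₀ → ∃₂ λ a b → a ≢ b × emb a ∉ E₀ × emb b ∉ E₀
  two-outside-E₀ {x} x∉
    with a , refl ← position-outside {x} (λ { refl → x∉ i∈E₀ }) (λ { refl → x∉ j∈E₀ })
    with L , hL , i∈L , a∈L ← line {i} {emb a} (emb≢i ∘ sym)
    with z , z∈L , z≢i , z≢a ← third hL i (emb a)
    with b , refl ← position-outside z≢i (λ { refl → x∉ (subst (emb a ∈_) (≡E₀ hL i∈L z∈L) a∈L) }) =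
    a , b , (λ { refl → z≢a refl }) , x∉ ,
    λ b∈ → x∉ (subst (emb a ∈_) (unique emb≢i hL E₀-edge z∈L i∈L b∈ i∈E₀) a∈L)

module _ {n} {H : Hypergraph (suc (suc n))} (T : ThickLinearSpace H) (e e′ : Pair (suc (suc n))) where
  open ThickLinearSpace T
  private
    module A = Deletion e
    module B = Deletion e′
    module AH = Contracting T e
    module BH = Contracting T e′
    module AD = DoublePairs T e
    module BD = DoublePairs T e′
    open Adjacency T e using (E₀; E₀-edge; i∈E₀)

  doublePair-map : ∀ φ → IsIso AH.contracted BH.contracted φ → ∀ {u v} → AD.DoublePair u v → BD.DoublePair (φ ⟨$⟩ʳ u) (φ ⟨$⟩ʳ v)
  doublePair-map φ iso (AD.doublePair u≢v {Y} {Y′} Y≢Y′ cY cY′ u∈Y v∈Y u∈Y′ v∈Y′) =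
    BD.doublePair (u≢v ∘ perm-injective φ) {image (φ ⟨$⟩ʳ_) Y} {image (φ ⟨$⟩ʳ_) Y′} (Y≢Y′ ∘ image-injective (perm-injective φ))
      (trans (sym (iso Y)) cY) (trans (sym (iso Y′)) cY′)
      (∈-image⁺ (φ ⟨$⟩ʳ_) Y u∈Y) (∈-image⁺ (φ ⟨$⟩ʳ_) Y v∈Y) (∈-image⁺ (φ ⟨$⟩ʳ_) Y′ u∈Y′) (∈-image⁺ (φ ⟨$⟩ʳ_) Y′ v∈Y′)

  -- Each of two leaf pairs is mapped to a pair containing `B.l`. Were `B.l` not the image of the
  -- centre, it would be the image of both leaves.
  iso-fixes-l : ∀ φ → IsIso AH.contracted BH.contracted φ → ∀ {x} → x ∉ E₀ → φ ⟨$⟩ʳ A.l ≡ B.l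
  iso-fixes-l φ iso x∉ with a , b , a≢b , a∉ , b∉ ← AD.two-outside-E₀ x∉
    with BD.doublePair⇒l (doublePair-map φ iso (AD.outside-E₀⇒doublePair a∉))
       | BD.doublePair⇒l (doublePair-map φ iso (AD.outside-E₀⇒doublePair b∉))
  ... | inj₁ p | _      = p
  ... | inj₂ _ | inj₁ q = q
  ... | inj₂ p | inj₂ q = ⊥-elim (a≢b (Fₚ.punchIn-injective A.l a b (perm-injective φ (trans p (sym q)))))

  -- Every edge has two points, which lie on `E₀`; so `E₀` is the only edge, and it contains the
  -- deleted pair.
  deleted-empty : (∀ x → x ∈ E₀) → ∀ (d : Pair (suc (suc n))) X → Contracting.deleted T d X ≡ false
  deleted-empty full d X = Bₚ.¬-not λ p → D.emb-¬Meets X (inj₁ (subst (D.i ∈_) (sym (only p)) (full D.i)))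
    where
    module D = Deletion d
    only : ∀ {E} → H E ≡ true → E ≡ E₀
    only hE with x , x∈ , _ ← third hE D.i D.i with y , y∈ , y≢x , _ ← third hE x x =
      unique y≢x hE E₀-edge y∈ x∈ (full y) (full x)

  contracted≅⇒deleted≅ : AH.contracted ≅ BH.contracted → AH.deleted ≅ BH.deleted
  contracted≅⇒deleted≅ iso with Fₚ.all? (_∈? E₀)
  ... | yes full = ≗⇒≅ AH.deleted BH.deleted λ X → trans (deleted-empty full e X) (sym (deleted-empty full e′ X))
  ... | no ¬full with x , x∉ ← Fₚ.¬∀⟶∃¬ _ _ (_∈? E₀) ¬full with φ , eq ← ≅⇒perm AH.contracted BH.contracted iso =
    perm⇒≅ AH.deleted BH.deleted (Compatible.ψ C) (IsIso-from-edges AH.deleted BH.deleted (Compatible.ψ C)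
      (Transfer.edges⇒deleted T C λ hE _ → forth hE)
      (Transfer.edges⇒deleted T C′ λ hE _ → back hE))
    where
    C = compatible-remove e e′ φ (iso-fixes-l φ eq x∉)
    C′ = compatible-flip C
    forth : Transfer.EdgeMap T C
    forth = Transfer.contracted⇒edges T C λ Y p → trans (sym (eq Y)) p
    back : Transfer.EdgeMap T C′
    back = Transfer.contracted⇒edges T C′ λ Y p → trans (sym (IsIso-flip AH.contracted BH.contracted φ eq Y)) p

-- Minors

collision? : ∀ {n p} (σ : Fin n → Fin p) → (Σ (Pair n) λ e → σ (Pair.i e) ≡ σ (Pair.j e)) ⊎ Injective _≡_ _≡_ σ
collision? σ with Fₚ.any? (λ i → Fₚ.any? (λ j → (i F.<? j) ×-dec (σ i ≟ σ j)))
... | yes (i , j , i<j , eq) = inj₁ (pair i<j , eq)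
... | no none = inj₂ injective
  where
  injective : Injective _≡_ _≡_ σ
  injective {x} {y} eq with Fₚ.<-cmp x y
  ... | tri≈ _ p _ = p
  ... | tri< p _ _ = ⊥-elim (none (x , y , p , eq))
  ... | tri> _ _ p = ⊥-elim (none (y , x , p , sym eq))

injective⇒retraction : ∀ {n p} {σ : Fin (suc n) → Fin p} → Injective _≡_ _≡_ σ → ∃ λ (τ : Fin p → Fin (suc n)) → ∀ x → τ (σ x) ≡ x
injective⇒retraction {n} {p} {σ} inj = τ , τσ
  where
  τ : Fin p → Fin (suc n)
  τ y with Fₚ.any? (λ x → σ x ≟ y)
  ... | yes (x , _) = x
  -- An arbitrary value off the image of `σ`; it exists because the domain is `Fin (suc n)`.
  ... | no _ = zero
  τσ : ∀ x → τ (σ x) ≡ x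
  τσ x with Fₚ.any? (λ z → σ z ≟ σ x)
  ... | yes (z , eq) = inj eq
  ... | no none = ⊥-elim (none (x , refl))

Surj : ∀ {n m} → (Fin n → Fin m) → Set
Surj σ = ∀ y → ∃ λ x → σ x ≡ y

Surj⇒≤ : ∀ {n m} {σ : Fin n → Fin m} → Surj σ → m ≤ n
Surj⇒≤ {σ = σ} s = Fₚ.injective⇒≤ {f = proj₁ ∘ s} λ {x} {y} eq → trans (sym (proj₂ (s x))) (trans (cong σ eq) (proj₂ (s y)))

Surj⇒perm : ∀ {n} (σ : Fin n → Fin n) → Surj σ → Σ (Permutation′ n) λ π → (π ⟨$⟩ʳ_) ≗ σ
Surj⇒perm {zero} σ s = Perm.id , λ ()
Surj⇒perm {suc n} σ s = Perm.permutation σ τ (proj₂ ∘ s) τσ , λ _ → refl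
  where
  τ = proj₁ ∘ s
  τσ : ∀ x → τ (σ x) ≡ x
  τσ x with x ≟ τ (σ x)
  ... | yes p = sym p
  -- Otherwise the section `τ` misses `x`, and punching `x` out gives an injection into a set with
  -- one element fewer.
  ... | no ne = ⊥-elim (ℕₚ.1+n≰n (Fₚ.injective⇒≤ {f = λ y → punchOut (avoids y)} λ {y} {z} eq →
      trans (sym (proj₂ (s y))) (trans (cong σ (Fₚ.punchOut-injective (avoids y) (avoids z) eq)) (proj₂ (s z)))))
    where
    avoids : ∀ y → x ≢ τ y
    avoids y eq = ne (trans eq (cong τ (trans (sym (proj₂ (s y))) (cong σ (sym eq)))))

-- By uniqueness of polynomials this says that all variables of `fH H` are essential.
Covered : ∀ {n} → Hypergraph n → Set
Covered H = ∀ x → ∃ λ E → H E ≡ true × x ∈ E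

minor⇒push : ∀ {n m} (H : Hypergraph n) (G : Hypergraph m) ((σ , _) : (m , fH G) ≤m (n , fH H)) → G ≗ push σ H
minor⇒push H G (σ , eq) = fH-injective G (push σ H) λ a → trans (eq a) (sym (fH-push σ H a))

-- By uniqueness of polynomials every edge of `G` is the image of an edge of `H`, and the edges of
-- `G` cover all vertices.
covered-minor⇒Surj : ∀ {n m} (H : Hypergraph n) (G : Hypergraph m) → Covered G → (g≤f : (m , fH G) ≤m (n , fH H)) → Surj (proj₁ g≤f)
covered-minor⇒Surj H G cov g≤f@(σ , _) y =
  let Y , gY , y∈Y = cov y
      E , _ , eq   = push⁻ σ H Y (trans (sym (minor⇒push H G g≤f Y)) gY)
      x , _ , σx≡y = ∈-image⁻ σ E (subst (y ∈_) (sym eq) y∈Y)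
  in x , σx≡y

≤m-trans : ∀ f g k → f ≤m g → g ≤m k → f ≤m k
≤m-trans _ _ _ (σ , p) (τ , q) = σ ∘ τ , λ a → trans (p a) (q (a ∘ σ))

covered-minors⇒≅ : ∀ {n} (H G : Hypergraph n) → Covered G → (n , fH G) ≤m (n , fH H) → H ≅ G
covered-minors⇒≅ H G cov g≤f =
  let π , eq = Surj⇒perm (proj₁ g≤f) (covered-minor⇒Surj H G cov g≤f)
  in push⇒≅ H G π λ Y → trans (push-cong {H = H} eq (λ _ → refl) Y) (sym (minor⇒push H G g≤f Y))

≅⇒minor : ∀ {n m} (H : Hypergraph n) (G : Hypergraph m) → H ≅ G → (m , fH G) ≤m (n , fH H)
≅⇒minor H G iso = let π , eq = ≅⇒perm H G iso in (π ⟨$⟩ʳ_) , λ a → begin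
  fH G a                       ≡⟨ fH-≗ (λ Y → pushed π eq Y) a ⟨
  fH (push (π ⟨$⟩ʳ_) H) a      ≡⟨ fH-push (π ⟨$⟩ʳ_) H a ⟩
  fH H (a ∘ (π ⟨$⟩ʳ_))         ∎
  where
  pushed : ∀ π → IsIso H G π → push (π ⟨$⟩ʳ_) H ≗ G
  pushed π eq Y = begin
    push (π ⟨$⟩ʳ_) H Y                                       ≡⟨ cong (push (π ⟨$⟩ʳ_) H) (image-flip π Y) ⟨
    push (π ⟨$⟩ʳ_) H (image (π ⟨$⟩ʳ_) (image (π ⟨$⟩ˡ_) Y))   ≡⟨ push-injective (perm-injective π) H _ ⟩
    H (image (π ⟨$⟩ˡ_) Y)                                    ≡⟨ IsIso-flip H G π eq Y ⟨
    G Y                                                      ∎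

contraction : ∀ {n} → Hypergraph (suc n) → Pair (suc n) → BF
contraction {n} H e = n , fH (contract H i j i<j)
  where open Pair e

module _ {n} (H : Hypergraph (suc n)) where

  contraction≤ : ∀ e → contraction H e ≤m (suc n , fH H)
  contraction≤ e = h , fH-contract H
    where open Contraction e

  -- If `σ` is injective, a retraction gives the reverse comparison. Hence a strict minor identifies
  -- two variables, and `σ` factors through the contraction of that pair.
  <⇒≤contraction : ∀ {g} → g <m (suc n , fH H) → ∃ λ e → g ≤m contraction H e
  <⇒≤contraction {p , g} ((σ , eq) , f≰g) with collision? σ
  ... | inj₂ inj = let τ , τσ = injective⇒retraction inj in
    ⊥-elim (f≰g (τ , λ a → trans (fH-cong H (λ x → cong a (sym (τσ x)))) (sym (eq (a ∘ τ)))))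
  ... | inj₁ (e , σi≡σj) = e , σ ∘ punchIn j , λ a →
    trans (eq a) (trans (fH-cong H (λ x → cong a (factor x))) (sym (fH-contract H (a ∘ σ ∘ punchIn j))))
    where
    open Contraction e
    factor : ∀ x → σ x ≡ σ (punchIn j (h x))
    factor x with j-or-punchIn x
    ... | inj₁ refl = trans (sym σi≡σj) (cong σ (trans (sym punchIn-l) (cong (punchIn j) (sym h-j))))
    ... | inj₂ (y , refl) = cong (σ ∘ punchIn j) (sym (h-punchIn y))

  contraction< : Covered H → ∀ e → contraction H e <m (suc n , fH H)
  -- A reverse comparison would be a surjection onto a set with one more element.
  contraction< cov e = contraction≤ e , λ f≤g → ℕₚ.1+n≰n (Surj⇒≤ (covered-minor⇒Surj (contract H i j i<j) H cov f≤g))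
    where open Pair e

contractions≅⇒joinIrreducible : ∀ {m} (H : Hypergraph (suc (suc m))) → Covered H → ContractionsIsomorphic H → JoinIrreducible (suc (suc m) , fH H)
contractions≅⇒joinIrreducible H cov iso = contraction H e₀ , contraction< H cov e₀ , λ g g<f →
  let e , g≤ = <⇒≤contraction H g<f in
  ≤m-trans g (contraction H e) (contraction H e₀) g≤ (≅⇒minor (contr e₀) (contr e) (iso _ _ (Pair.i<j e₀) _ _ (Pair.i<j e)))
  where
  contr : Pair _ → Hypergraph _
  contr e = contract H (Pair.i e) (Pair.j e) (Pair.i<j e)
  e₀ : Pair _
  e₀ = pair {i = zero} {j = suc zero} (s≤s z≤n)

-- The largest strict minor `f′` lies below some contraction `e₀` and above all of them. So every
-- contraction is a minor of that at `e₀`, with equally many variables, all essential.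
joinIrreducible⇒contractions≅ : ∀ {m} (H : Hypergraph (suc m)) → Covered H →
  (∀ (e : Pair (suc m)) → Covered (contract H (Pair.i e) (Pair.j e) (Pair.i<j e))) →
  JoinIrreducible (suc m , fH H) → ContractionsIsomorphic H
joinIrreducible⇒contractions≅ H cov contr-cov (f′ , f′<f , greatest) i j i<j i′ j′ i′<j′ =
  ≅-trans (contr e) (contr e₀) (contr e′) (≅-sym (contr e₀) (contr e) (from-e₀ e)) (from-e₀ e′)
  where
  contr : Pair _ → Hypergraph _
  contr e = contract H (Pair.i e) (Pair.j e) (Pair.i<j e)
  e e′ e₀ : Pair _
  e = pair i<j
  e′ = pair i′<j′
  e₀ = proj₁ (<⇒≤contraction H f′<f)
  from-e₀ : ∀ d → contr e₀ ≅ contr d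
  from-e₀ d = covered-minors⇒≅ (contr e₀) (contr d) (contr-cov d)
    (≤m-trans (contraction H d) f′ (contraction H e₀) (greatest (contraction H d) (contraction< H cov d)) (proj₂ (<⇒≤contraction H f′<f)))

contracted-covered : ∀ {n} {H : Hypergraph (suc (suc n))} → ThickLinearSpace H → Covered H → ∀ e → Covered (contract H (Pair.i e) (Pair.j e) (Pair.i<j e))
contracted-covered T cov e y =
  let E , hE , p = cov (punchIn j y) in
  image h E , Contracting.contracted⁺ T e hE , subst (_∈ image h E) (h-punchIn y) (∈-image⁺ h E p)
  where open Contraction e

-- Steiner systems

∈-allSubsets : ∀ {n} (E : Subset n) → E ∈ˡ allSubsets n
∈-allSubsets [] = here refl
∈-allSubsets (true  ∷ E) = ∈-++⁺ˡ (∈-map⁺ (true ∷_) (∈-allSubsets E))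
∈-allSubsets (false ∷ E) = ∈-++⁺ʳ (map (true ∷_) (allSubsets _)) (∈-map⁺ (false ∷_) (∈-allSubsets E))

countS≡1⇒∃! : ∀ {n} (P : Subset n → Bool) → countS n P ≡ 1 → ∃ λ E → P E ≡ true × (∀ E′ → P E′ ≡ true → E′ ≡ E)
countS≡1⇒∃! {n} P c with filter (λ E → P E ≟ᵇ true) (allSubsets n) in eq
... | E ∷ [] = E , proj₂ (∈-filter⁻ (λ E → P E ≟ᵇ true) {xs = allSubsets n} (subst (E ∈ˡ_) (sym eq) (here refl))) , only
  where
  only : ∀ E′ → P E′ ≡ true → E′ ≡ E
  only E′ p with here q ← subst (E′ ∈ˡ_) eq (∈-filter⁺ (λ E → P E ≟ᵇ true) (∈-allSubsets E′) p) = q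

∣⁅x⁆∪p∣≤1+∣p∣ : ∀ {n} (x : Fin n) p → ∣ ⁅ x ⁆ ∪ p ∣ ≤ suc ∣ p ∣
∣⁅x⁆∪p∣≤1+∣p∣ zero (b ∷ p) rewrite Sₚ.∪-identityˡ p = s≤s (Sₚ.∣p∣≤∣x∷p∣ b p)
∣⁅x⁆∪p∣≤1+∣p∣ (suc x) (true ∷ p) = s≤s (∣⁅x⁆∪p∣≤1+∣p∣ x p)
∣⁅x⁆∪p∣≤1+∣p∣ (suc x) (false ∷ p) = ∣⁅x⁆∪p∣≤1+∣p∣ x p

∣⁅x⁆∪⁅y⁆∣≤2 : ∀ {n} (x y : Fin n) → ∣ ⁅ x ⁆ ∪ ⁅ y ⁆ ∣ ≤ 2
∣⁅x⁆∪⁅y⁆∣≤2 x y = ℕₚ.≤-trans (∣⁅x⁆∪p∣≤1+∣p∣ x ⁅ y ⁆) (s≤s (ℕₚ.≤-reflexive (Sₚ.∣⁅x⁆∣≡1 y)))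

larger⇒∃∉ : ∀ {n} (A E : Subset n) → ∣ A ∣ < ∣ E ∣ → ∃ λ x → x ∈ E × x ∉ A
larger⇒∃∉ A E lt with Fₚ.any? (λ x → (x ∈? E) ×-dec ¬? (x ∈? A))
... | yes found = found
... | no none = ⊥-elim (ℕₚ.<⇒≱ lt (Sₚ.p⊆q⇒∣p∣≤∣q∣ E⊆A))
  where
  E⊆A : E S.⊆ A
  E⊆A {x} x∈ with x ∈? A
  ... | yes p = Vₚ.lookup⇒[]= x A p
  ... | no ¬p = ⊥-elim (none (x , Vₚ.[]=⇒lookup x∈ , ¬p))

steiner⇒linear : ∀ {n k} {H : Hypergraph n} → IsSteiner n k H → LinearSpace H
steiner⇒linear {n} {H = H} (_ , cnt) = record
  { line = λ x≢y → let E , hE , p , q , _ = through x≢y in E , hE , p , q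
  ; unique = λ x≢y hE hE′ p q p′ q′ → let _ , _ , _ , _ , only = through x≢y in trans (only hE p q) (sym (only hE′ p′ q′))
  }
  where
  Through : Fin n → Fin n → Set
  Through x y = ∃ λ E → H E ≡ true × x ∈ E × y ∈ E × (∀ {E′} → H E′ ≡ true → x ∈ E′ → y ∈ E′ → E′ ≡ E)
  ordered : ∀ {x y} → x F.< y → Through x y
  ordered {x} {y} x<y =
    let E , p , only = countS≡1⇒∃! _ (cnt x y x<y)
        q = Bₚ.∧-conicalʳ (H E) _ p
    in E , Bₚ.∧-conicalˡ (H E) _ p , Bₚ.∧-conicalˡ (x ∈ᵇ E) _ q , Bₚ.∧-conicalʳ (x ∈ᵇ E) _ q ,
       λ hE′ r s → only _ (cong₂ _∧_ hE′ (cong₂ _∧_ r s))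
  through : ∀ {x y} → x ≢ y → Through x y
  through {x} {y} x≢y with Fₚ.<-cmp x y
  ... | tri< x<y _ _ = ordered x<y
  ... | tri≈ _ eq _ = ⊥-elim (x≢y eq)
  ... | tri> _ _ y<x = let E , hE , p , q , only = ordered y<x in E , hE , q , p , λ h r s → only h s r

steiner⇒thick : ∀ {n k} {H : Hypergraph n} → 3 ≤ k → IsSteiner n k H → ThickLinearSpace H
steiner⇒thick {H = H} 3≤k St = record { linear = steiner⇒linear St ; third = third }
  where
  third : ∀ {E} → H E ≡ true → ∀ a b → ∃ λ x → x ∈ E × x ≢ a × x ≢ b
  third {E} hE a b =
    -- The set formed by `a` and `b` has at most two elements, fewer than the edge.
    let x , x∈ , x∉ = larger⇒∃∉ (⁅ a ⁆ ∪ ⁅ b ⁆) E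
                        (ℕₚ.≤-trans (s≤s (∣⁅x⁆∪⁅y⁆∣≤2 a b)) (ℕₚ.≤-trans 3≤k (ℕₚ.≤-reflexive (sym (proj₁ St E hE)))))
    in x , x∈ , (λ x≡a → x∉ (∈-∪⁺ˡ ⁅ a ⁆ ⁅ b ⁆ (subst (_∈ ⁅ a ⁆) (sym x≡a) (∈-⁅⁆⁺ a)))) ,
       λ x≡b → x∉ (∈-∪⁺ʳ ⁅ a ⁆ ⁅ b ⁆ (subst (_∈ ⁅ b ⁆) (sym x≡b) (∈-⁅⁆⁺ b)))

linear⇒covered : ∀ {m} {H : Hypergraph (suc (suc m))} → LinearSpace H → Covered H
linear⇒covered L zero    = let E , hE , p , _ = LinearSpace.line L {zero} {suc zero} (λ ()) in E , hE , p
linear⇒covered L (suc x) = let E , hE , p , _ = LinearSpace.line L {suc x} {zero} (λ ()) in E , hE , p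

-- Two-element sets and the complete graph, k = 2

IsPairSet : ∀ {n} → Subset n → Set
IsPairSet E = ∃₂ λ x y → x ≢ y × x ∈ E × y ∈ E × (∀ {z} → z ∈ E → z ≡ x ⊎ z ≡ y)

IsPairSet-image : ∀ {n m} {φ : Fin n → Fin m} → Injective _≡_ _≡_ φ → ∀ {E} → IsPairSet E → IsPairSet (image φ E)
IsPairSet-image {φ = φ} inj {E} (x , y , x≢y , x∈ , y∈ , only) =
  φ x , φ y , x≢y ∘ inj , ∈-image⁺ φ E x∈ , ∈-image⁺ φ E y∈ , λ p → let z , z∈ , eq = ∈-image⁻ φ E p in
    [ (λ q → inj₁ (trans (sym eq) (cong φ q))) , (λ q → inj₂ (trans (sym eq) (cong φ q))) ]′ (only z∈)

IsPairSet-image⁻ : ∀ {n m} {φ : Fin n → Fin m} → Injective _≡_ _≡_ φ → ∀ {E} → IsPairSet (image φ E) → IsPairSet E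
IsPairSet-image⁻ {φ = φ} inj {E} (u , v , u≢v , u∈ , v∈ , only) =
  let x , x∈ , φx≡u = ∈-image⁻ φ E u∈
      y , y∈ , φy≡v = ∈-image⁻ φ E v∈
  in x , y , (λ x≡y → u≢v (trans (sym φx≡u) (trans (cong φ x≡y) φy≡v))) , x∈ , y∈ , λ z∈ →
     [ (λ q → inj₁ (inj (trans q (sym φx≡u)))) , (λ q → inj₂ (inj (trans q (sym φy≡v)))) ]′ (only (∈-image⁺ φ E z∈))

∣E∣≡2⇒IsPairSet : ∀ {n} (E : Subset n) → ∣ E ∣ ≡ 2 → IsPairSet E
∣E∣≡2⇒IsPairSet {n} E c =
  let x , x∈ , _ = larger⇒∃∉ S.⊥ E (subst (_< ∣ E ∣) (sym (Sₚ.∣⊥∣≡0 n)) (subst (0 <_) (sym c) (s≤s z≤n)))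
      y , y∈ , y∉ = larger⇒∃∉ ⁅ x ⁆ E (subst (_< ∣ E ∣) (sym (Sₚ.∣⁅x⁆∣≡1 x)) (subst (1 <_) (sym c) (s≤s (s≤s z≤n))))
      x≢y = λ x≡y → y∉ (subst (_∈ ⁅ x ⁆) x≡y (∈-⁅⁆⁺ x))
  in x , y , x≢y , x∈ , y∈ , only x≢y x∈ y∈
  where
  only : ∀ {x y} → x ≢ y → x ∈ E → y ∈ E → ∀ {z} → z ∈ E → z ≡ x ⊎ z ≡ y
  only {x} {y} x≢y x∈ y∈ {z} z∈ with z ≟ x | z ≟ y
  ... | yes p | _ = inj₁ p
  ... | no _ | yes q = inj₂ q
  -- A third element would give a strictly increasing chain from the singleton of `x` through `mid`
  -- to `E`, forcing at least three elements.
  ... | no z≢x | no z≢y = ⊥-elim (ℕₚ.1+n≰n (ℕₚ.≤-trans (s≤s (ℕₚ.≤-trans (s≤s (ℕₚ.≤-reflexive (sym (Sₚ.∣⁅x⁆∣≡1 x)))) small<mid)) (subst (∣ mid ∣ <_) c mid<E)))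
    where
    mid = ⁅ x ⁆ ∪ ⁅ y ⁆
    in-mid : ∀ {w} → w ∈ mid → w ≡ x ⊎ w ≡ y
    in-mid p = [ (λ q → inj₁ (∈-⁅⁆⁻ q)) , (λ q → inj₂ (∈-⁅⁆⁻ q)) ]′ (∈-∪⁻ ⁅ x ⁆ ⁅ y ⁆ p)
    small<mid : ∣ ⁅ x ⁆ ∣ < ∣ mid ∣
    small<mid = Sₚ.p⊂q⇒∣p∣<∣q∣ (Sₚ.p⊆p∪q ⁅ y ⁆ , y , Vₚ.lookup⇒[]= y mid (∈-∪⁺ʳ ⁅ x ⁆ ⁅ y ⁆ (∈-⁅⁆⁺ y)) , λ q → x≢y (sym (Sₚ.x∈⁅y⁆⇒x≡y x q)))
    mid<E : ∣ mid ∣ < ∣ E ∣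
    mid<E = Sₚ.p⊂q⇒∣p∣<∣q∣ {p = mid} {q = E}
      ( (λ {w} w∈ → Vₚ.lookup⇒[]= w E ([ (λ { refl → x∈ }) , (λ { refl → y∈ }) ]′ (in-mid {w} (Vₚ.[]=⇒lookup w∈))))
      , z , Vₚ.lookup⇒[]= z E z∈ , λ w∈ → [ z≢x , z≢y ]′ (in-mid {z} (Vₚ.[]=⇒lookup w∈)))

module Complete {m} {H : Hypergraph (suc (suc m))} (St : IsSteiner (suc (suc m)) 2 H) where
  open LinearSpace (steiner⇒linear St)

  edge⇒pair : ∀ {E} → H E ≡ true → IsPairSet E
  edge⇒pair {E} hE = ∣E∣≡2⇒IsPairSet E (proj₁ St E hE)

  -- The line through the two points is itself a two-element set, hence equal to `E`.
  pair⇒edge : ∀ {E} → IsPairSet E → H E ≡ true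
  pair⇒edge {E} (x , y , x≢y , x∈ , y∈ , only) with L , hL , x∈′ , y∈′ ← line x≢y
    with u , v , u≢v , u∈ , v∈ , only′ ← edge⇒pair hL =
    trans (cong H (subset-ext λ z → ⇔⇒≡ to (from z))) hL
    where
    to : ∀ {z} → z ∈ E → z ∈ L
    to p = [ (λ { refl → x∈′ }) , (λ { refl → y∈′ }) ]′ (only p)
    from : ∀ z → z ∈ L → z ∈ E
    from z p with only′ x∈′ | only′ y∈′ | only′ p
    ... | inj₁ refl | inj₁ refl | _         = ⊥-elim (x≢y refl)
    ... | inj₂ refl | inj₂ refl | _         = ⊥-elim (x≢y refl)
    ... | inj₁ refl | inj₂ refl | inj₁ refl = x∈
    ... | inj₁ refl | inj₂ refl | inj₂ refl = y∈
    ... | inj₂ refl | inj₁ refl | inj₁ refl = y∈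
    ... | inj₂ refl | inj₁ refl | inj₂ refl = x∈

  -- The edges are exactly the two-element sets, which injections preserve and reflect.
  H-image : ∀ {p} {f g : Fin p → Fin (suc (suc m))} → Injective _≡_ _≡_ f → Injective _≡_ _≡_ g → ∀ X → H (image f X) ≡ H (image g X)
  H-image f-inj g-inj X = ⇔⇒≡
    (λ q → pair⇒edge (IsPairSet-image g-inj {X} (IsPairSet-image⁻ f-inj {X} (edge⇒pair q))))
    (λ q → pair⇒edge (IsPairSet-image f-inj {X} (IsPairSet-image⁻ g-inj {X} (edge⇒pair q))))

  minus2Monomorphic : Minus2Monomorphic H
  minus2Monomorphic i j i<j i′ j′ i′<j′ = ≗⇒≅ (delete H i j i<j) (delete H i′ j′ i′<j′)
    (H-image (Deletion.emb-injective (pair i<j)) (Deletion.emb-injective (pair i′<j′)))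

  push-perm : ∀ (π : Permutation′ (suc (suc m))) → push (π ⟨$⟩ʳ_) H ≗ H
  push-perm π Y = begin
    push (π ⟨$⟩ʳ_) H Y                     ≡⟨ cong (push (π ⟨$⟩ʳ_) H) (image-flip π Y) ⟨
    push (π ⟨$⟩ʳ_) H (image (π ⟨$⟩ʳ_) Z)   ≡⟨ push-injective (perm-injective π) H Z ⟩
    H Z                                    ≡⟨ cong H (image-id Z) ⟨
    H (image id Z)                         ≡⟨ H-image id (perm-injective π) Z ⟩
    H (image (π ⟨$⟩ʳ_) Z)                  ≡⟨ cong H (image-flip π Y) ⟩
    H Y                                    ∎
    where
    Z = image (π ⟨$⟩ˡ_) Y

  -- For k = 2 contraction is not injective on edges, so edges are not followed. Instead a
  -- permutation `π` of the vertices carries one pair to the other and induces `φ`; `H` is invariant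
  -- under `π`.
  contractionsIsomorphic : ContractionsIsomorphic H
  contractionsIsomorphic i j i<j i′ j′ i′<j′ = push⇒≅ (contract H i j i<j) (contract H i′ j′ i′<j′) φ λ Y → begin
    push (φ ⟨$⟩ʳ_) (contract H i j i<j) Y  ≡⟨ push-cong {σ = φ ⟨$⟩ʳ_} (λ _ → refl) (A.contract≗push H) Y ⟩
    push (φ ⟨$⟩ʳ_) (push A.h H) Y          ≡⟨ push-∘ (φ ⟨$⟩ʳ_) A.h H Y ⟩
    push ((φ ⟨$⟩ʳ_) ∘ A.h) H Y             ≡⟨ push-cong {H = H} square (λ _ → refl) Y ⟩
    push (B.h ∘ (π ⟨$⟩ʳ_)) H Y             ≡⟨ push-∘ B.h (π ⟨$⟩ʳ_) H Y ⟨
    push B.h (push (π ⟨$⟩ʳ_) H) Y          ≡⟨ push-cong {σ = B.h} (λ _ → refl) (push-perm π) Y ⟩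
    push B.h H Y                           ≡⟨ B.contract≗push H Y ⟨
    contract H i′ j′ i′<j′ Y               ∎
    where
    module A = Contraction (pair i<j)
    module B = Contraction (pair i′<j′)
    φ = insert A.l B.l Perm.id
    π = insert j j′ φ
    square : (φ ⟨$⟩ʳ_) ∘ A.h ≗ B.h ∘ (π ⟨$⟩ʳ_)
    square x with A.j-or-punchIn x
    ... | inj₁ refl = trans (cong (φ ⟨$⟩ʳ_) A.h-j) (trans (insert-at A.l B.l Perm.id) (sym (trans (cong B.h (insert-at j j′ φ)) B.h-j)))
    ... | inj₂ (y , refl) = trans (cong (φ ⟨$⟩ʳ_) (A.h-punchIn y)) (sym (trans (cong B.h (insert-punchIn j j′ φ y)) (B.h-punchIn _)))

theorem3p10 : (m k : ℕ) (H : Hypergraph (suc (suc m))) →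
    2 ≤ k → k ≤ suc (suc m) → IsSteiner (suc (suc m)) k H →
    (JoinIrreducible (suc (suc m) , fH H) ⇔ ContractionsIsomorphic H) ×
    (ContractionsIsomorphic H ⇔ Minus2Monomorphic H)
theorem3p10 m (suc zero) H (s≤s ())
theorem3p10 m (suc (suc zero)) H _ _ St =
  mk⇔ (λ _ → contractionsIsomorphic) (contractions≅⇒joinIrreducible H (linear⇒covered (steiner⇒linear St))) ,
  mk⇔ (λ _ → minus2Monomorphic) (λ _ → contractionsIsomorphic)
  where open Complete St
theorem3p10 m (suc (suc (suc k))) H _ _ St =
  mk⇔ (joinIrreducible⇒contractions≅ H cov (contracted-covered T cov)) (contractions≅⇒joinIrreducible H cov) ,
  mk⇔ (λ iso i j i<j i′ j′ i′<j′ → contracted≅⇒deleted≅ T (pair i<j) (pair i′<j′) (iso i j i<j i′ j′ i′<j′))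
      (λ iso i j i<j i′ j′ i′<j′ → deleted≅⇒contracted≅ T (pair i<j) (pair i′<j′) (iso i j i<j i′ j′ i′<j′))
  where
  T : ThickLinearSpace H
  T = steiner⇒thick (s≤s (s≤s (s≤s z≤n))) St
  cov : Covered H
  cov = linear⇒covered (steiner⇒linear St)
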